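{- Let $F$ be a $3$-graph. If $F$ is $3$-partite, then there is $\varepsilon=\varepsilon(F)>0$ such that $\mathrm{co^+ex}(n,F)\le O(n^{1-\varepsilon})$ as $n\to\infty$. Otherwise, $\mathrm{co^+ex}(n,F)=\Theta(n)$ as $n\to\infty$. (Implied constants may depend on $F$.)
   Context: A $3$-graph is a finite $3$-uniform hypergraph. It is $3$-partite if its vertex set can be partitioned into three classes such that each edge intersects each class in at most one vertex. The minimum positive co-degree $\delta_2^+(H)$ of a non-empty $3$-graph $H$ is the maximum $k$ such that every pair of vertices contained in some edge of $H$ is contained in at least $k$ distinct edges of $H$; by convention it is $0$ if $H$ has no edges. A hypergraph is $F$-free if it has no (not necessarily induced) subhypergraph isomorphic to $F$. $\mathrm{co^+ex}(n,F)$ is the maximum of $\delta_2^+(H)$ over all $n$-vertex $F$-free $3$-graphs $H$ (taken to be $0$ if there are none). -}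

module Defs where

open import Data.Bool.Base using (true; false)
import Data.Bool.Properties as Bool
open import Data.Fin.Base as Fin using (Fin; finToFun; funToFin)
import Data.Fin.Properties as Fin
open import Data.Fin.Subset using (Subset; inside; outside; ∣_∣; _∈_)
open import Data.Fin.Subset.Properties using (_∈?_)
open import Data.Integer.Base using (+_; -[1+_])
open import Data.List.Base using (List; []; _∷_; [_]; _++_; map; filter; length)
open import Data.List.Extrema.Nat using (max; v≤max⁺; argmax-sel)
import Data.List.Membership.DecPropositional as DecMembership
import Data.List.Membership.Propositional as List
open import Data.List.Membership.Propositional.Properties
  using (∈-map⁺; ∈-map⁻; ∈-++⁺ˡ; ∈-++⁺ʳ; ∈-filter⁺; ∈-filter⁻)
open import Data.List.Membership.Propositional.Properties.WithK using (unique∧set⇒bag)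
open import Data.List.Properties using (length-filter)
open import Data.List.Relation.Binary.BagAndSetEquality using (∼bag⇒↭)
open import Data.List.Relation.Binary.Permutation.Propositional.Properties using (↭-length)
open import Data.List.Relation.Unary.All as All using (All; []; _∷_; all?)
open import Data.List.Relation.Unary.All.Properties using (all-filter)
open import Data.List.Relation.Unary.AllPairs using ([]; _∷_)
open import Data.List.Relation.Unary.Any as Any using (any?)
open import Data.List.Relation.Unary.Unique.Propositional using (Unique)
import Data.List.Relation.Unary.Unique.Propositional.Properties as Unique
open import Data.Nat.Base using (ℕ; zero; suc; _*_; _^_; _≤_; z≤n; s≤s⁻¹)
open import Data.Nat.Properties
  using (_≟_; _≤?_; suc-injective; ≤-reflexive; ≤-trans; m≤n⇒m<n∨m≡n)
open import Data.Product using (Σ; ∃; _×_; _,_; proj₁; proj₂)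
open import Data.Rational.Base using (ℚ; mkℚ)
open import Data.Sum.Base using (_⊎_; inj₁; inj₂)
open import Data.Unit.Base using (tt)
open import Data.Vec.Base using ([]; _∷_; tabulate; here; there)
open import Data.Vec.Properties
  using (≡-dec; ∷-injectiveʳ; lookup∘tabulate; tabulate-cong; []=⇒lookup; lookup⇒[]=)
open import Function.Base using (id; _∘_; _$_)
open import Function.Bundles using (_⇔_; mk⇔; Equivalence)
open import Function.Definitions using (Injective)
open import Level using (0ℓ)
open import Relation.Binary.PropositionalEquality
  using (_≡_; _≢_; refl; sym; trans; cong; subst)
open import Relation.Nullary
  using (¬_; Dec; yes; no; does; ¬?; _×-dec_; _→-dec_; map′; contradiction)
open import Relation.Nullary.Decidable using (dec-true; does-⇔)
open import Relation.Unary using (Pred; Decidable)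

------------------------------------------------------------------------
-- 3-graphs

-- The edge set is a duplicate-free list; the order of the list is irrelevant
-- to every notion below.
record ThreeGraph (n : ℕ) : Set where
  field
    edges    : List (Subset n)
    distinct : Unique edges
    uniform  : All (λ e → ∣ e ∣ ≡ 3) edges

  Edge : Subset n → Set
  Edge e = e List.∈ edges

open ThreeGraph public

ThreePartite : ∀ {n} → ThreeGraph n → Set
ThreePartite {n} H =
  Σ (Fin n → Fin 3) λ class →
    ∀ e → Edge H e → ∀ u v → u ∈ e → v ∈ e → class u ≡ class v → u ≡ v

image : ∀ {m n} → (Fin m → Fin n) → Subset m → Subset n
image f e = tabulate λ w → does (Fin.any? λ v → (v ∈? e) ×-dec (f v Fin.≟ w))

∈-image : ∀ {m n} (f : Fin m → Fin n) (e : Subset m) (w : Fin n) →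
          w ∈ image f e ⇔ ∃ λ v → v ∈ e × f v ≡ w
∈-image {m} {n} f e w = mk⇔ to from
  where
  P? : (w : Fin n) → Dec (∃ λ v → v ∈ e × f v ≡ w)
  P? w = Fin.any? λ v → (v ∈? e) ×-dec (f v Fin.≟ w)

  to : w ∈ image f e → ∃ λ v → v ∈ e × f v ≡ w
  to p with P? w | trans (sym (lookup∘tabulate (does ∘ P?) w)) ([]=⇒lookup p)
  ... | yes q | _ = q
  ... | no _  | ()

  from : (∃ λ v → v ∈ e × f v ≡ w) → w ∈ image f e
  from q = lookup⇒[]= w _
    (trans (lookup∘tabulate (does ∘ P?) w) (dec-true (P? w) q))

-- f maps F isomorphically onto a (not necessarily induced) subhypergraph of H.
IsCopy : ∀ {m n} → ThreeGraph m → ThreeGraph n → (Fin m → Fin n) → Set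
IsCopy F H f = Injective _≡_ _≡_ f × (∀ e → Edge F e → Edge H (image f e))

Free : ∀ {m n} → ThreeGraph m → ThreeGraph n → Set
Free F H = ¬ ∃ (IsCopy F H)

------------------------------------------------------------------------
-- Maxima of decidable sets of natural numbers

IsMaximum : Pred ℕ 0ℓ → Pred ℕ 0ℓ
IsMaximum P k = P k × (∀ j → P j → j ≤ k)

-- The greatest k ≤ b satisfying P, and 0 if there is none.
greatest : ∀ {P : Pred ℕ 0ℓ} → Decidable P → ℕ → ℕ
greatest P? zero = zero
greatest P? (suc b) with P? (suc b)
... | yes _ = suc b
... | no  _ = greatest P? b

greatest-isMaximum : ∀ {P : Pred ℕ 0ℓ} (P? : Decidable P) b →
                     P 0 → (∀ j → P j → j ≤ b) → IsMaximum P (greatest P? b)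
greatest-isMaximum P? zero    p₀ bound = p₀ , bound
greatest-isMaximum P? (suc b) p₀ bound with P? (suc b)
... | yes p = p , bound
... | no ¬p = greatest-isMaximum P? b p₀ bound′
  where
  bound′ : ∀ j → _ → j ≤ b
  bound′ j q with m≤n⇒m<n∨m≡n (bound j q)
  ... | inj₁ j<1+b = s≤s⁻¹ j<1+b
  ... | inj₂ refl  = contradiction q ¬p

------------------------------------------------------------------------
-- Minimum positive co-degree

Joins : ∀ {n} → Fin n → Fin n → Subset n → Set
Joins u v e = u ∈ e × v ∈ e

joins? : ∀ {n} (u v : Fin n) → Decidable (Joins u v)
joins? u v e = (u ∈? e) ×-dec (v ∈? e)

codegree : ∀ {n} → ThreeGraph n → Fin n → Fin n → ℕ
codegree H u v = length (filter (joins? u v) (edges H))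

CodegreeAtLeast : ∀ {n} → ThreeGraph n → ℕ → Set
CodegreeAtLeast H k =
  ∀ u v → u ≢ v → (∃ λ e → Edge H e × Joins u v e) → k ≤ codegree H u v

codegreeAtLeast? : ∀ {n} (H : ThreeGraph n) → Decidable (CodegreeAtLeast H)
codegreeAtLeast? H k =
  Fin.all? λ u → Fin.all? λ v → ¬? (u Fin.≟ v) →-dec
    (covered? u v →-dec (k ≤? codegree H u v))
  where
  covered? : ∀ u v → Dec (∃ λ e → Edge H e × Joins u v e)
  covered? u v = map′ List.find (λ (_ , e∈H , uv) → List.lose e∈H uv)
                      (any? (joins? u v) (edges H))

-- For non-empty H the bound ∣E(H)∣ excludes nothing (see δ₂⁺-isMaximum);
-- for empty H it yields the convention δ₂⁺(H) = 0.
δ₂⁺ : ∀ {n} → ThreeGraph n → ℕ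
δ₂⁺ H = greatest (codegreeAtLeast? H) (length (edges H))

δ₂⁺-empty : ∀ {n} (H : ThreeGraph n) → (∀ e → ¬ Edge H e) → δ₂⁺ H ≡ 0
δ₂⁺-empty record { edges = [] }    _  = refl
δ₂⁺-empty record { edges = e ∷ _ } ¬E = contradiction (Any.here refl) (¬E e)

private
  member : ∀ {n k} (e : Subset n) → ∣ e ∣ ≡ suc k → ∃ (_∈ e)
  member (inside  ∷ e) _  = Fin.zero , here
  member (outside ∷ e) eq = let u , u∈e = member e eq in Fin.suc u , there u∈e

  distinctMembers : ∀ {n k} (e : Subset n) → ∣ e ∣ ≡ suc (suc k) →
                    ∃ λ u → ∃ λ v → u ≢ v × Joins u v e
  distinctMembers (inside ∷ e) eq =
    let v , v∈e = member e (suc-injective eq)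
    in Fin.zero , Fin.suc v , (λ ()) , here , there v∈e
  distinctMembers (outside ∷ e) eq =
    let u , v , u≢v , u∈e , v∈e = distinctMembers e eq
    in Fin.suc u , Fin.suc v , u≢v ∘ Fin.suc-injective , there u∈e , there v∈e

δ₂⁺-isMaximum : ∀ {n} (H : ThreeGraph n) → ∃ (Edge H) →
                IsMaximum (CodegreeAtLeast H) (δ₂⁺ H)
δ₂⁺-isMaximum H (e , e∈H) =
  greatest-isMaximum (codegreeAtLeast? H) _ (λ _ _ _ _ → z≤n) bound
  where
  bound : ∀ j → CodegreeAtLeast H j → j ≤ length (edges H)
  bound j p =
    let u , v , u≢v , uv = distinctMembers e (All.lookup (uniform H) e∈H)
    in ≤-trans (p u v u≢v (e , e∈H , uv)) (length-filter (joins? u v) (edges H))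

------------------------------------------------------------------------
-- The positive co-degree extremal number

allSubsets : ∀ n → List (Subset n)
allSubsets zero    = [ [] ]
allSubsets (suc n) =
  map (inside ∷_) (allSubsets n) ++ map (outside ∷_) (allSubsets n)

∈-allSubsets : ∀ {n} (e : Subset n) → e List.∈ allSubsets n
∈-allSubsets []            = Any.here refl
∈-allSubsets (inside  ∷ e) = ∈-++⁺ˡ (∈-map⁺ (inside ∷_) (∈-allSubsets e))
∈-allSubsets (outside ∷ e) = ∈-++⁺ʳ _ (∈-map⁺ (outside ∷_) (∈-allSubsets e))

allSubsets-unique : ∀ n → Unique (allSubsets n)
allSubsets-unique zero    = [] ∷ []
allSubsets-unique (suc n) = Unique.++⁺
  (Unique.map⁺ ∷-injectiveʳ (allSubsets-unique n))
  (Unique.map⁺ ∷-injectiveʳ (allSubsets-unique n))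
  disjoint
  where
  disjoint : ∀ {e} → ¬ (e List.∈ map (inside ∷_) (allSubsets n) ×
                        e List.∈ map (outside ∷_) (allSubsets n))
  disjoint (p , q) with ∈-map⁻ (inside ∷_) p | ∈-map⁻ (outside ∷_) q
  ... | _ , _ , refl | _ , _ , ()

sublists : ∀ {A : Set} → List A → List (List A)
sublists []       = [ [] ]
sublists (x ∷ xs) = map (x ∷_) (sublists xs) ++ sublists xs

filter∈sublists : ∀ {A : Set} {P : Pred A 0ℓ} (P? : Decidable P) xs →
                  filter P? xs List.∈ sublists xs
filter∈sublists P? [] = Any.here refl
filter∈sublists P? (x ∷ xs) with does (P? x)
... | true  = ∈-++⁺ˡ (∈-map⁺ (x ∷_) (filter∈sublists P? xs))
... | false = ∈-++⁺ʳ _ (filter∈sublists P? xs)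

module _ {n : ℕ} where

  open DecMembership (≡-dec {n = n} Bool._≟_) using () renaming (_∈?_ to _∈ˡ?_)

  edge? : (H : ThreeGraph n) → Decidable (Edge H)
  edge? H e = e ∈ˡ? edges H

  private
    tripleIn? : (es : List (Subset n)) → Decidable (λ e → e List.∈ es × ∣ e ∣ ≡ 3)
    tripleIn? es e = (e ∈ˡ? es) ×-dec (∣ e ∣ ≟ 3)

  fromList : List (Subset n) → ThreeGraph n
  fromList es = record
    { edges    = filter (tripleIn? es) (allSubsets n)
    ; distinct = Unique.filter⁺ (tripleIn? es) (allSubsets-unique n)
    ; uniform  = All.map proj₂ (all-filter (tripleIn? es) (allSubsets n))
    }

  edge-fromList : ∀ es e → Edge (fromList es) e ⇔ (e List.∈ es × ∣ e ∣ ≡ 3)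
  edge-fromList es e = mk⇔
    (proj₂ ∘ ∈-filter⁻ (tripleIn? es) {xs = allSubsets n})
    (∈-filter⁺ (tripleIn? es) (∈-allSubsets e))

allThreeGraphs : ∀ n → List (ThreeGraph n)
allThreeGraphs n = map fromList (sublists (allSubsets n))

_≈ᴱ_ : ∀ {n} → ThreeGraph n → ThreeGraph n → Set
H ≈ᴱ K = ∀ e → Edge H e ⇔ Edge K e

allThreeGraphs-complete : ∀ {n} (H : ThreeGraph n) →
                          ∃ λ K → K List.∈ allThreeGraphs n × H ≈ᴱ K
allThreeGraphs-complete {n} H =
  fromList es , ∈-map⁺ fromList (filter∈sublists (edge? H) (allSubsets n)) , same
  where
  es : List (Subset n)
  es = filter (edge? H) (allSubsets n)

  same : H ≈ᴱ fromList es
  same e = mk⇔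
    (λ e∈H → Equivalence.from (edge-fromList es e)
      (∈-filter⁺ (edge? H) (∈-allSubsets e) e∈H , All.lookup (uniform H) e∈H))
    (λ e∈K → proj₂ (∈-filter⁻ (edge? H) {xs = allSubsets n}
      (proj₁ (Equivalence.to (edge-fromList es e) e∈K))))

codegree-cong : ∀ {n} {H K : ThreeGraph n} → H ≈ᴱ K →
                ∀ u v → codegree H u v ≡ codegree K u v
codegree-cong {H = H} {K} H≈K u v = ↭-length $ ∼bag⇒↭ $ unique∧set⇒bag
  (Unique.filter⁺ J? (distinct H)) (Unique.filter⁺ J? (distinct K))
  (λ {e} → mk⇔ (transfer H K λ {e} → Equivalence.to (H≈K e))
               (transfer K H λ {e} → Equivalence.from (H≈K e)))
  where
  J? = joins? u v

  transfer : ∀ H K → (∀ {e} → Edge H e → Edge K e) → ∀ {e} →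
             e List.∈ filter J? (edges H) → e List.∈ filter J? (edges K)
  transfer H K sub p =
    let e∈H , uv = ∈-filter⁻ J? {xs = edges H} p in ∈-filter⁺ J? (sub e∈H) uv

δ₂⁺-mono-≈ᴱ : ∀ {n} {H K : ThreeGraph n} → H ≈ᴱ K → δ₂⁺ H ≤ δ₂⁺ K
δ₂⁺-mono-≈ᴱ {H = H} {K} H≈K with any? (λ _ → yes tt) (edges H)
... | no ¬E = ≤-trans (≤-reflexive (δ₂⁺-empty H λ _ e∈H → ¬E (List.lose e∈H tt))) z≤n
... | yes E = proj₂ (δ₂⁺-isMaximum K (e , Equivalence.to (H≈K e) e∈H)) (δ₂⁺ H) atLeast
  where
  e = proj₁ (List.find E)
  e∈H = proj₁ (proj₂ (List.find E))

  atLeast : CodegreeAtLeast K (δ₂⁺ H)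
  atLeast u v u≢v (e′ , e′∈K , uv) = subst (δ₂⁺ H ≤_) (codegree-cong {H = H} {K} H≈K u v)
    (proj₁ (δ₂⁺-isMaximum H (e , e∈H)) u v u≢v
      (e′ , Equivalence.from (H≈K e′) e′∈K , uv))

free-resp-≈ᴱ : ∀ {m n} (F : ThreeGraph m) {H K : ThreeGraph n} →
               H ≈ᴱ K → Free F H → Free F K
free-resp-≈ᴱ F H≈K free (f , inj , emb) =
  free (f , inj , λ e e∈F → Equivalence.from (H≈K (image f e)) (emb e e∈F))

free? : ∀ {m n} (F : ThreeGraph m) → Decidable (Free {m} {n} F)
free? {m} {n} F H =
  ¬? (map′ (λ (i , p) → finToFun i , p) encode (Fin.any? λ i → isCopy? (finToFun i)))
  where
  injective? : (f : Fin m → Fin n) → Dec (Injective _≡_ _≡_ f)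
  injective? f = map′ (λ p {u} {v} → p u v) (λ p u v → p)
    (Fin.all? λ u → Fin.all? λ v → (f u Fin.≟ f v) →-dec (u Fin.≟ v))

  isCopy? : (f : Fin m → Fin n) → Dec (IsCopy F H f)
  isCopy? f = injective? f ×-dec
    map′ (λ p e → All.lookup p) (λ p → All.tabulate λ {e} → p e)
      (all? (λ e → edge? H (image f e)) (edges F))

  encode : ∃ (IsCopy F H) → ∃ λ (i : Fin (n ^ m)) → IsCopy F H (finToFun i)
  encode (f , inj , emb) = funToFin f , inj′ , emb′
    where
    g = finToFun (funToFin f)

    g≗f : ∀ v → g v ≡ f v
    g≗f = Fin.finToFun-funToFin f

    inj′ : Injective _≡_ _≡_ g
    inj′ {u} {v} eq = inj (trans (sym (g≗f u)) (trans eq (g≗f v)))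

    image≡ : ∀ e → image f e ≡ image g e
    image≡ e = tabulate-cong λ w → does-⇔
      (mk⇔ (λ (v , v∈e , eq) → v , v∈e , trans (g≗f v) eq)
           (λ (v , v∈e , eq) → v , v∈e , trans (sym (g≗f v)) eq))
      (Fin.any? λ v → (v ∈? e) ×-dec (f v Fin.≟ w))
      (Fin.any? λ v → (v ∈? e) ×-dec (g v Fin.≟ w))

    emb′ : ∀ e → Edge F e → Edge H (image g e)
    emb′ e e∈F = subst (Edge H) (image≡ e) (emb e e∈F)

-- The start value 0 is the convention for an empty family; co⁺ex-upper and
-- co⁺ex-attained show that every 3-graph on Fin n is accounted for.
co⁺ex : ∀ {m} → ℕ → ThreeGraph m → ℕ
co⁺ex n F = max 0 (map δ₂⁺ (filter (free? F) (allThreeGraphs n)))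

co⁺ex-upper : ∀ {m n} (F : ThreeGraph m) (H : ThreeGraph n) →
              Free F H → δ₂⁺ H ≤ co⁺ex n F
co⁺ex-upper {n = n} F H free =
  let K , K∈ , H≈K = allThreeGraphs-complete H
      K∈filter = ∈-filter⁺ (free? F) K∈ (free-resp-≈ᴱ F {H} {K} H≈K free)
  in v≤max⁺ 0 _ (inj₂ (List.lose (∈-map⁺ δ₂⁺ K∈filter) (δ₂⁺-mono-≈ᴱ {H = H} {K} H≈K)))

co⁺ex-attained : ∀ {m} n (F : ThreeGraph m) →
                 co⁺ex n F ≡ 0 ⊎ ∃ λ (H : ThreeGraph n) → Free F H × δ₂⁺ H ≡ co⁺ex n F
co⁺ex-attained n F with argmax-sel id 0 (map δ₂⁺ (filter (free? F) (allThreeGraphs n)))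
... | inj₁ ≡0 = inj₁ ≡0
... | inj₂ ∈δ =
  let H , H∈ , eq = ∈-map⁻ δ₂⁺ ∈δ
  in inj₂ (H , proj₂ (∈-filter⁻ (free? F) {xs = allThreeGraphs n} H∈) , sym eq)

------------------------------------------------------------------------
-- Asymptotics as n → ∞

-- x ≤ C · n ^ s for rational s and n > 0, with the root and the negative
-- power cleared: for s = ± a / q, raise both sides to the q-th power and, if
-- s < 0, multiply by n ^ a.
_≤_·_^ℚ_ : ℕ → ℕ → ℕ → ℚ → Set
x ≤ C · n ^ℚ mkℚ (+ a)    q-1 _ = x ^ suc q-1 ≤ C ^ suc q-1 * n ^ a
x ≤ C · n ^ℚ mkℚ -[1+ a ] q-1 _ = x ^ suc q-1 * n ^ suc a ≤ C ^ suc q-1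

-- f(n) = O(n ^ s)
_=O[n^_] : (ℕ → ℕ) → ℚ → Set
f =O[n^ s ] = ∃ λ C → ∃ λ N → ∀ n → N ≤ n → f n ≤ C · n ^ℚ s

_=O_ : (ℕ → ℕ) → (ℕ → ℕ) → Set
f =O g = ∃ λ C → ∃ λ N → ∀ n → N ≤ n → f n ≤ C * g n

-- The lower bound f(n) ≥ c · g(n) with real c > 0 is g(n) ≤ C · f(n), C ≥ 1 / c.
_=Θ_ : (ℕ → ℕ) → (ℕ → ℕ) → Set
f =Θ g = f =O g × g =O f

{-# OPTIONS --safe #-}

-- Let k be the minimum positive co-degree of a non-empty F-free H on n
-- vertices and t = ∣V(F)∣.  At least k² ordered pairs lie in edges, and each of
-- them has k common neighbours, so a greedy choice of t vertices z, each kept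
-- by a k/n fraction of the surviving pairs, leaves a common link of size about
-- k² (k/n)ᵗ.  If F is 3-partite, this link contains no K_{t,t}.  Choosing t
-- vertices y in the same way for the vertices x of high degree in the link then
-- gives k^q = O(n^(q-1)) with q = (t + 1)(t + 2), that is, ε = 1/q.
-- If F is not 3-partite, the balanced complete 3-partite 3-graph is F-free.
module Submission where

open import Defs
open import Data.Empty using (⊥-elim)
open import Data.Fin.Base as Fin using (Fin; toℕ; fromℕ<; inject≤)
open import Data.Fin.Patterns using (0F; 1F; 2F)
import Data.Fin.Properties as Fin
open import Data.Fin.Subset
  using (Subset; inside; outside; ⁅_⁆; _∪_; ∣_∣; ⊥; _∈_; _∉_; _⊆_)
open import Data.Fin.Subset.Properties
  using ( _∈?_; drop-there; x∈⁅x⁆; x∈⁅y⁆⇒x≡y; ∣⁅x⁆∣≡1; x∈p∪q⁺; x∈p∪q⁻; ∪-assoc; ∪-comm; ∪-idem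
        ; ∪-identityˡ; ∪-identityʳ; Empty-unique; x∈p⇒∣p-x∣<∣p∣; ⊆-antisym)
import Data.Integer.Base as ℤ
open import Data.List.Base
  using (List; []; _∷_; _++_; map; filter; length; cartesianProduct; allFin; upTo; lookup)
import Data.List.Membership.Propositional as List
open import Data.List.Membership.Propositional.Properties
  using ( ∈-filter⁺; ∈-filter⁻; ∈-∃++; ∈-++⁻; ∈-++⁺ˡ; ∈-++⁺ʳ
        ; ∈-lookup; ∈-allFin; ∈-upTo⁻)
open import Data.List.Properties
  using (length-++; length-filter; length-tabulate; length-upTo; filter-all; filter-++)
open import Data.List.Relation.Unary.All as All using (All; []; _∷_; all?)
open import Data.List.Relation.Unary.AllPairs using ([]; _∷_)
open import Data.List.Relation.Unary.Any using (here; there)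
open import Data.List.Relation.Unary.Unique.Propositional using (Unique)
import Data.List.Relation.Unary.Unique.Propositional.Properties as Unique
open import Data.Nat.Base hiding (_<_)
import Data.Nat.Base as ℕ
open import Data.Nat.Coprimality as Coprime using (Coprime)
open import Data.Nat.DivMod
  using ( _mod_; m≡m%n+[m/n]*n; m%n<n; m/n*n≤m; m≥n⇒m/n>0
        ; [m+kn]%n≡m%n; m<n⇒m%n≡m)
open import Data.Nat.ListAction using (sum)
open import Data.Nat.Properties
open import Data.Nat.Solver using (module +-*-Solver)
open import Data.Product using (∃; _×_; _,_; proj₁; proj₂; uncurry)
open import Data.Rational.Base using (ℚ; mkℚ; 0ℚ; 1ℚ; _<_; _-_)
import Data.Rational.Base as ℚ
import Data.Rational.Properties as ℚ
import Data.Rational.Unnormalised.Base as ℚᵘ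
import Data.Rational.Unnormalised.Properties as ℚᵘ
open import Data.Sum.Base using (_⊎_; inj₁; inj₂; [_,_]′)
open import Data.Vec.Base using ([]; _∷_; here; there)
open import Function.Base using (_∘_; _$_; id)
open import Function.Bundles using (Equivalence)
open import Function.Definitions using (Injective)
open import Relation.Binary.Definitions using (DecidableEquality) renaming (Decidable to Decidable₂)
open import Relation.Binary.PropositionalEquality
open import Relation.Nullary using (¬_; Dec; yes; no; ¬?; contradiction; _×-dec_; _→-dec_)
open import Relation.Nullary.Decidable using (from-yes)
open import Relation.Unary using (Decidable)
open import Relation.Unary.Properties using (U?)

open +-*-Solver using (solve; _:=_; _:*_; _:+_; con)
open import Algebra.Properties.CommutativeSemigroup *-commutativeSemigroup
  using (xy∙z≈xz∙y; interchange; x∙yz≈y∙xz)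
open import Algebra.Properties.CommutativeSemigroup +-commutativeSemigroup
  using () renaming (x∙yz≈y∙xz to exchange)

private
  variable
    m n : ℕ
    A B : Set

-- Counting in lists

count : {P : A → Set} → Decidable P → List A → ℕ
count P? xs = length (filter P? xs)

module _ {R : A → B → Set} where

  -- Induction on `xs`: the partner of the first element is deleted from `ys`, and injectivity keeps
  -- the partners of the others in what remains. A relation suits the later uses, where a partner,
  -- such as the third vertex of an edge, is only known to exist.
  length-≤ : ∀ {xs} → Unique xs → ∀ ys →
             (∀ {x} → x List.∈ xs → ∃ λ y → y List.∈ ys × R x y) →
             (∀ {x x′ y} → x List.∈ xs → x′ List.∈ xs → R x y → R x′ y → x ≡ x′) →
             length xs ≤ length ys
  length-≤ {[]}     []         ys total inj = z≤n
  length-≤ {x ∷ xs} (x∉ ∷ uxs) ys total inj with total (here refl)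
  ... | y , y∈ys , xRy with ∈-∃++ y∈ys
  ... | as , bs , refl = begin
    suc (length xs)               ≤⟨ s≤s (length-≤ uxs (as ++ bs) total′ (λ p q → inj (there p) (there q))) ⟩
    suc (length (as ++ bs))       ≡⟨ cong suc (length-++ as) ⟩
    suc (length as + length bs)   ≡⟨ +-suc (length as) (length bs) ⟨
    length as + length (y ∷ bs)   ≡⟨ length-++ as ⟨
    length (as ++ y ∷ bs)         ∎
    where
    open ≤-Reasoning
    total′ : ∀ {x′} → x′ List.∈ xs → ∃ λ y → y List.∈ as ++ bs × R x′ y
    total′ x′∈ with total (there x′∈)
    ... | y′ , y′∈ , x′Ry′ with ∈-++⁻ as y′∈
    ...   | inj₁ p         = y′ , ∈-++⁺ˡ p , x′Ry′
    ...   | inj₂ (there p) = y′ , ∈-++⁺ʳ as p , x′Ry′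
    ...   | inj₂ (here refl) =
      contradiction (inj (here refl) (there x′∈) xRy x′Ry′) (All.lookup x∉ x′∈)

module _ {P Q : A → Set} {P? : Decidable P} {Q? : Decidable Q} where

  count-mono : (∀ {x} → P x → Q x) → ∀ xs → count P? xs ≤ count Q? xs
  count-mono P⇒Q [] = z≤n
  count-mono P⇒Q (x ∷ xs) with P? x | Q? x
  ... | yes _ | yes _ = s≤s (count-mono P⇒Q xs)
  ... | yes p | no ¬q = contradiction (P⇒Q p) ¬q
  ... | no _  | yes _ = m≤n⇒m≤1+n (count-mono P⇒Q xs)
  ... | no _  | no _  = count-mono P⇒Q xs

  count-filter : {S : A → Set} {S? : Decidable S} → (∀ {x} → P x → Q x → S x) →
                 ∀ xs → count P? (filter Q? xs) ≤ count S? xs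
  count-filter P∧Q⇒S [] = z≤n
  count-filter {S? = S?} P∧Q⇒S (x ∷ xs) with Q? x
  ... | no _ with S? x
  ...   | yes _ = m≤n⇒m≤1+n (count-filter P∧Q⇒S xs)
  ...   | no  _ = count-filter P∧Q⇒S xs
  count-filter {S? = S?} P∧Q⇒S (x ∷ xs) | yes q with P? x | S? x
  ... | yes _ | yes _ = s≤s (count-filter P∧Q⇒S xs)
  ... | yes p | no ¬s = contradiction (P∧Q⇒S p q) ¬s
  ... | no _  | yes _ = m≤n⇒m≤1+n (count-filter P∧Q⇒S xs)
  ... | no _  | no  _ = count-filter P∧Q⇒S xs

module _ {P : A → Set} (P? : Decidable P) (f : A → ℕ) where

  count*≤sum : ∀ k xs → (∀ {x} → x List.∈ xs → P x → k ≤ f x) →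
               count P? xs * k ≤ sum (map f xs)
  count*≤sum k []       k≤f = z≤n
  count*≤sum k (x ∷ xs) k≤f with P? x
  ... | yes p = +-mono-≤ (k≤f (here refl) p) (count*≤sum k xs (k≤f ∘ there))
  ... | no  _ = m≤n⇒m≤o+n (f x) (count*≤sum k xs (k≤f ∘ there))

  sum≤count : ∀ N D xs → (∀ x → f x ≤ N) → (∀ {x} → ¬ P x → f x ≤ D) →
              sum (map f xs) ≤ count P? xs * N + length xs * D
  sum≤count N D []       f≤N f≤D = z≤n
  sum≤count N D (x ∷ xs) f≤N f≤D with P? x
  ... | yes _ = begin
    f x + sum (map f xs)                          ≤⟨ +-mono-≤ (f≤N x) (sum≤count N D xs f≤N f≤D) ⟩
    -- This `D` is slack: `length xs` also counts the elements that satisfy `P`.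
    N + (count P? xs * N + length xs * D)         ≤⟨ +-monoʳ-≤ N (+-monoʳ-≤ (count P? xs * N) (m≤n+m _ D)) ⟩
    N + (count P? xs * N + (D + length xs * D))   ≡⟨ +-assoc N _ _ ⟨
    N + count P? xs * N + (D + length xs * D)     ∎
    where open ≤-Reasoning
  ... | no ¬p = begin
    f x + sum (map f xs)                      ≤⟨ +-mono-≤ (f≤D ¬p) (sum≤count N D xs f≤N f≤D) ⟩
    D + (count P? xs * N + length xs * D)     ≡⟨ +-comm D _ ⟩
    count P? xs * N + length xs * D + D       ≡⟨ +-assoc (count P? xs * N) _ D ⟩
    count P? xs * N + (length xs * D + D)     ≡⟨ cong (count P? xs * N +_) (+-comm _ D) ⟩
    count P? xs * N + (D + length xs * D)     ∎
    where open ≤-Reasoning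

length≡count : ∀ {P : A → Set} (P? : Decidable P) {xs} → (∀ {x} → x List.∈ xs → P x) →
               length xs ≡ count P? xs
length≡count P? p = cong length (sym (filter-all P? (All.tabulate p)))

module _ {R : A → B → Set} (R? : Decidable₂ R) where

  private
    sum-zero : ∀ (ys : List B) → sum (map (λ _ → 0) ys) ≡ 0
    sum-zero []       = refl
    sum-zero (_ ∷ ys) = sum-zero ys

    insert : ∀ x xs ys → count (R? x) ys + sum (map (λ y → count (λ x → R? x y) xs) ys) ≡
                         sum (map (λ y → count (λ x → R? x y) (x ∷ xs)) ys)
    insert x xs [] = refl
    insert x xs (y ∷ ys) with R? x y
    ... | yes _ = cong suc (trans (exchange (count (R? x) ys) c _) (cong (c +_) (insert x xs ys)))
      where c = count (λ x → R? x y) xs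
    ... | no  _ = trans (exchange (count (R? x) ys) c _) (cong (c +_) (insert x xs ys))
      where c = count (λ x → R? x y) xs

  double-count : ∀ xs ys → sum (map (λ x → count (R? x) ys) xs) ≡
                           sum (map (λ y → count (λ x → R? x y) xs) ys)
  double-count []       ys = sym (sum-zero ys)
  double-count (x ∷ xs) ys =
    trans (cong (count (R? x) ys +_) (double-count xs ys)) (insert x xs ys)

  count-map-, : ∀ x ys → count (uncurry R?) (map (x ,_) ys) ≡ count (R? x) ys
  count-map-, x [] = refl
  count-map-, x (y ∷ ys) with R? x y
  ... | yes _ = cong suc (count-map-, x ys)
  ... | no  _ = count-map-, x ys

  count-× : ∀ xs ys → count (uncurry R?) (cartesianProduct xs ys) ≡
                      sum (map (λ x → count (R? x) ys) xs)
  count-× [] ys = refl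
  count-× (x ∷ xs) ys = begin
    count (uncurry R?) (map (x ,_) ys ++ cartesianProduct xs ys)
      ≡⟨ cong length (filter-++ (uncurry R?) (map (x ,_) ys) _) ⟩
    length (filter (uncurry R?) (map (x ,_) ys) ++ filter (uncurry R?) (cartesianProduct xs ys))
      ≡⟨ length-++ (filter (uncurry R?) (map (x ,_) ys)) ⟩
    count (uncurry R?) (map (x ,_) ys) + count (uncurry R?) (cartesianProduct xs ys)
      ≡⟨ cong₂ _+_ (count-map-, x ys) (count-× xs ys) ⟩
    count (R? x) ys + sum (map (λ x → count (R? x) ys) xs) ∎
    where open ≡-Reasoning

-- Averaging and greedy selection

pigeonhole : ∀ (f : A → ℕ) x xs → ∃ λ z → z List.∈ x ∷ xs × sum (map f (x ∷ xs)) ≤ length (x ∷ xs) * f z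
pigeonhole f x [] = x , here refl , ≤-refl
pigeonhole f x (y ∷ ys) with pigeonhole f y ys
... | z , z∈ , sum≤ with ≤-total (f x) (f z)
... | inj₁ fx≤fz = z , there z∈ , +-mono-≤ fx≤fz sum≤
... | inj₂ fz≤fx = x , here refl , +-monoʳ-≤ (f x) (≤-trans sum≤ (*-monoʳ-≤ (length (y ∷ ys)) fz≤fx))

m*n>0⇒m>0 : ∀ {m n} → 0 ℕ.< m * n → 0 ℕ.< m
m*n>0⇒m>0 {suc _} _ = z<s

-- The related pairs number at least `length xs * d`. Counted from the side of `cs`, some `z` has at
-- least the average share of them.
popular : ∀ {R : A → B → Set} (R? : Decidable₂ R) {d N} → 0 ℕ.< d →
          ∀ xs → 0 ℕ.< length xs → ∀ cs → length cs ≤ N →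
          (∀ {x} → x List.∈ xs → d ≤ count (R? x) cs) →
          ∃ λ z → z List.∈ cs × length xs * d ≤ count (λ x → R? x z) xs * N
popular R? 0<d (x ∷ xs) _ [] _ deg = contradiction 0<d (≤⇒≯ (deg (here refl)))
popular R? {d} {N} 0<d xs _ cs@(c ∷ cs′) cs≤N deg
  with z , z∈ , sum≤ ← pigeonhole (λ z → count (λ x → R? x z) xs) c cs′ = z , z∈ , (begin
    length xs * d                                 ≡⟨ cong (_* d) (length≡count U? {xs} (λ _ → _)) ⟩
    count U? xs * d                               ≤⟨ count*≤sum U? _ d xs (λ x∈ _ → deg x∈) ⟩
    sum (map (λ x → count (R? x) cs) xs)          ≡⟨ double-count R? xs cs ⟩
    sum (map (λ z → count (λ x → R? x z) xs) cs)  ≤⟨ sum≤ ⟩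
    length cs * count (λ x → R? x z) xs           ≤⟨ *-monoˡ-≤ _ cs≤N ⟩
    N * count (λ x → R? x z) xs                   ≡⟨ *-comm N _ ⟩
    count (λ x → R? x z) xs * N                   ∎)
  where open ≤-Reasoning

module _ {B : Set} (_≟ᴮ_ : DecidableEquality B) where

  remove : B → List B → List B
  remove z = filter (λ y → ¬? (y ≟ᴮ z))

  -- In a duplicate-free list `z` occurs at most once, so at most one element is lost.
  count-remove : ∀ {P : B → Set} (P? : Decidable P) z {ys} → Unique ys →
                 count P? ys ≤ suc (count P? (remove z ys))
  count-remove P? z {[]} [] = z≤n
  count-remove P? z {y ∷ ys} (y∉ ∷ uys) with y ≟ᴮ z
  ... | yes refl = subst (λ zs → count P? (y ∷ ys) ≤ suc (count P? zs))
                         (sym (filter-all _ (All.map (_∘ sym) y∉))) bound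
    where
    bound : count P? (y ∷ ys) ≤ suc (count P? ys)
    bound with P? y
    ... | yes _ = ≤-refl
    ... | no  _ = n≤1+n _
  ... | no _ with P? y
  ...   | yes _ = s≤s (count-remove P? z uys)
  ...   | no  _ = count-remove P? z uys

  -- Greedy choice: some candidate z is adjacent to a d/N fraction of xs, and
  -- removing it from the candidates lowers every degree by at most one.
  select : ∀ {A : Set} {R : A → B → Set} (R? : Decidable₂ R) {d N} t → 0 ℕ.< d →
           ∀ xs → 0 ℕ.< length xs → ∀ {cs} → Unique cs → length cs ≤ N →
           (∀ {x} → x List.∈ xs → t + d ≤ count (R? x) cs) →
           ∃ λ zs → Unique zs × (∀ {z} → z List.∈ zs → z List.∈ cs) × length zs ≡ t ×
             length xs * d ^ t ≤ count (λ x → all? (R? x) zs) xs * N ^ t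
  select R? zero 0<d xs 0<xs ucs cs≤N deg =
    [] , [] , (λ ()) , refl ,
    *-monoˡ-≤ 1 (≤-reflexive (length≡count (λ x → all? (R? x) []) {xs} (λ _ → [])))
  select R? {d} {N} (suc t) 0<d xs 0<xs {cs} ucs cs≤N deg
    with z , z∈ , step ← popular R? 0<d xs 0<xs cs cs≤N (λ x∈ → ≤-trans (m≤n+m d (suc t)) (deg x∈))
    with zs , uzs , zs⊆ , |zs| , bound ←
      select R? t 0<d (filter (λ x → R? x z) xs)
        -- The surviving list is nonempty because `step` bounds a positive number by a multiple of
        -- its length.
        (m*n>0⇒m>0 (≤-trans (*-mono-≤ 0<xs 0<d) step))
        (Unique.filter⁺ (λ y → ¬? (y ≟ᴮ z)) ucs) (≤-trans (length-filter _ cs) cs≤N)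
        (λ x∈ → s≤s⁻¹ (≤-trans (deg (proj₁ (∈-filter⁻ (λ x → R? x z) x∈)))
                               (count-remove (R? _) z ucs))) =
    z ∷ zs , All.tabulate (λ z′∈ → proj₂ (kept z′∈) ∘ sym) ∷ uzs ,
    (λ { (here refl) → z∈ ; (there z′∈) → proj₁ (kept z′∈) }) , cong suc |zs| , (begin
      length xs * (d * d ^ t)      ≡⟨ *-assoc (length xs) d _ ⟨
      length xs * d * d ^ t        ≤⟨ *-monoˡ-≤ (d ^ t) step ⟩
      length xs′ * N * d ^ t       ≡⟨ xy∙z≈xz∙y (length xs′) N _ ⟩
      length xs′ * d ^ t * N       ≤⟨ *-monoˡ-≤ N bound ⟩
      count (λ x → all? (R? x) zs) xs′ * N ^ t * N
        ≤⟨ *-monoˡ-≤ N (*-monoˡ-≤ (N ^ t) (count-filter (λ ps p → p ∷ ps) xs)) ⟩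
      count (λ x → all? (R? x) (z ∷ zs)) xs * N ^ t * N
        ≡⟨ *-assoc (count (λ x → all? (R? x) (z ∷ zs)) xs) _ N ⟩
      count (λ x → all? (R? x) (z ∷ zs)) xs * (N ^ t * N)
        ≡⟨ cong (count (λ x → all? (R? x) (z ∷ zs)) xs *_) (*-comm _ N) ⟩
      count (λ x → all? (R? x) (z ∷ zs)) xs * (N * N ^ t)  ∎)
    where
    open ≤-Reasoning
    xs′ = filter (λ x → R? x z) xs

    kept : ∀ {z′} → z′ List.∈ zs → z′ List.∈ cs × z′ ≢ z
    kept z′∈ = ∈-filter⁻ (λ y → ¬? (y ≟ᴮ z)) {xs = cs} (zs⊆ z′∈)

-- Arithmetic of the power bounds

^-distribʳ-* : ∀ m n o → (m * n) ^ o ≡ m ^ o * n ^ o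
^-distribʳ-* m n zero    = refl
^-distribʳ-* m n (suc o) = begin
  m * n * (m * n) ^ o      ≡⟨ cong (m * n *_) (^-distribʳ-* m n o) ⟩
  m * n * (m ^ o * n ^ o)  ≡⟨ interchange m n _ _ ⟩
  m * m ^ o * (n * n ^ o)  ∎
  where open ≡-Reasoning

m<[1+m/n]*n : ∀ m n .{{_ : NonZero n}} → m ℕ.< suc (m / n) * n
m<[1+m/n]*n m n = begin-strict
  m                    ≡⟨ m≡m%n+[m/n]*n m n ⟩
  m % n + m / n * n    <⟨ +-monoˡ-< (m / n * n) (m%n<n m n) ⟩
  n + m / n * n        ∎
  where open ≤-Reasoning

-- The hypothesis is used with t + D = ⌊g / 2N⌋, so that the last summand
-- is at most half of the left-hand side.
threshold⇒power-bound : ∀ t g N .{{_ : NonZero N}} →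
           (∀ {D} → 0 ℕ.< D → g * D ^ t ≤ t * N ^ suc t + N * (t + D) * D ^ t) →
           g ^ suc t ≤ (4 * suc t) ^ suc t * N ^ (t + suc t)
-- Beyond `2t` the quotient `u` leaves `D = u - t > t`, so that `g` and `N * D` agree up to a
-- constant factor.
threshold⇒power-bound t g N hyp with t + t <? _/_ g (2 * N) {{m*n≢0 2 N}}
-- A quotient of at most `2t` means that `g` is at most a multiple of `N`, which is stronger than
-- the bound.
... | no 2t≮u = begin
  g ^ suc t                              ≤⟨ ^-monoˡ-≤ (suc t) (<⇒≤ (m<[1+m/n]*n g (2 * N))) ⟩
  (suc (g / (2 * N)) * (2 * N)) ^ suc t  ≤⟨ ^-monoˡ-≤ (suc t) (*-monoˡ-≤ (2 * N) (s≤s (≮⇒≥ 2t≮u))) ⟩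
  (suc (t + t) * (2 * N)) ^ suc t        ≤⟨ ^-monoˡ-≤ (suc t) (*-monoˡ-≤ (2 * N) (n≤1+n (suc (t + t)))) ⟩
  (suc (suc (t + t)) * (2 * N)) ^ suc t  ≡⟨ cong (_^ suc t) (lemma t N) ⟩
  (4 * suc t * N) ^ suc t                ≡⟨ ^-distribʳ-* (4 * suc t) N (suc t) ⟩
  (4 * suc t) ^ suc t * N ^ suc t        ≤⟨ *-monoʳ-≤ ((4 * suc t) ^ suc t) (^-monoʳ-≤ N (m≤n+m (suc t) t)) ⟩
  (4 * suc t) ^ suc t * N ^ (t + suc t)  ∎
  where
  open ≤-Reasoning
  instance _ = m*n≢0 2 N
  lemma : ∀ t N → suc (suc (t + t)) * (2 * N) ≡ 4 * suc t * N
  lemma = solve 2 (λ t N → (con 2 :+ (t :+ t)) :* (con 2 :* N) := con 4 :* (con 1 :+ t) :* N) refl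
... | yes 2t<u = begin
  g * g ^ t                                ≤⟨ *-monoʳ-≤ g (^-monoˡ-≤ t g≤) ⟩
  g * (4 * N * D) ^ t                      ≡⟨ cong (g *_) (^-distribʳ-* (4 * N) D t) ⟩
  g * ((4 * N) ^ t * D ^ t)                ≡⟨ x∙yz≈y∙xz g ((4 * N) ^ t) _ ⟩
  (4 * N) ^ t * (g * D ^ t)                ≤⟨ *-monoʳ-≤ ((4 * N) ^ t) half ⟩
  (4 * N) ^ t * (2 * (t * N ^ suc t))      ≡⟨ cong₂ _*_ (^-distribʳ-* 4 N t) (sym (*-assoc 2 t _)) ⟩
  4 ^ t * N ^ t * (2 * t * N ^ suc t)      ≡⟨ interchange (4 ^ t) (N ^ t) _ _ ⟩
  -- The constant is rounded up to the one obtained in the other case.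
  4 ^ t * (2 * t) * (N ^ t * N ^ suc t)    ≤⟨ *-mono-≤ (*-mono-≤ (^-monoˡ-≤ t (m≤m*n 4 (suc t))) (*-mono-≤ {2} {4} (s≤s (s≤s z≤n)) (n≤1+n t)))
                                                      (≤-reflexive (sym (^-distribˡ-+-* N t (suc t)))) ⟩
  (4 * suc t) ^ t * (4 * suc t) * N ^ (t + suc t)  ≡⟨ cong (_* N ^ (t + suc t)) (*-comm ((4 * suc t) ^ t) _) ⟩
  (4 * suc t) ^ suc t * N ^ (t + suc t)    ∎
  where
  open ≤-Reasoning
  instance _ = m*n≢0 2 N
  u = g / (2 * N)
  D = u ∸ t

  t+D≡u : t + D ≡ u
  t+D≡u = m+[n∸m]≡n (≤-trans (m≤m+n t t) (<⇒≤ 2t<u))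

  t<D : t ℕ.< D
  t<D = +-cancelˡ-< t t D (<-≤-trans 2t<u (≤-reflexive (sym t+D≡u)))

  g≤ : g ≤ 4 * N * D
  g≤ = begin
    g                        ≤⟨ <⇒≤ (m<[1+m/n]*n g (2 * N)) ⟩
    suc u * (2 * N)          ≡⟨ cong (λ v → suc v * (2 * N)) (sym t+D≡u) ⟩
    (suc t + D) * (2 * N)    ≤⟨ *-monoˡ-≤ (2 * N) (+-monoˡ-≤ D t<D) ⟩
    (D + D) * (2 * N)        ≡⟨ solve 2 (λ D N → (D :+ D) :* (con 2 :* N) := con 4 :* N :* D) refl D N ⟩
    4 * N * D                ∎

  half : g * D ^ t ≤ 2 * (t * N ^ suc t)
  half = +-cancelʳ-≤ (g * D ^ t) (g * D ^ t) _ (begin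
    g * D ^ t + g * D ^ t                ≡⟨ cong (g * D ^ t +_) (sym (+-identityʳ _)) ⟩
    2 * (g * D ^ t)                      ≤⟨ *-monoʳ-≤ 2 (hyp (≤-<-trans z≤n t<D)) ⟩
    2 * (t * N ^ suc t + N * (t + D) * D ^ t)
      ≡⟨ cong (λ v → 2 * (t * N ^ suc t + N * v * D ^ t)) t+D≡u ⟩
    2 * (t * N ^ suc t + N * u * D ^ t)
      ≡⟨ solve 4 (λ x N u y → con 2 :* (x :+ N :* u :* y) := con 2 :* x :+ u :* (con 2 :* N) :* y)
           refl (t * N ^ suc t) N u (D ^ t) ⟩
    2 * (t * N ^ suc t) + u * (2 * N) * D ^ t
      ≤⟨ +-monoʳ-≤ (2 * (t * N ^ suc t)) (*-monoˡ-≤ (D ^ t) (m/n*n≤m g (2 * N))) ⟩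
    2 * (t * N ^ suc t) + g * D ^ t      ∎)

-- The exponent p satisfies 1 + p = (t + 1)(t + 2) definitionally.
codegree-power-bound : ∀ t d n c .{{_ : NonZero c}} → t ≤ d →
                    let p = t + (suc t + t * suc t) in
                    ((t + d) * (t + d) * d ^ t) ^ suc t ≤ c ^ suc t * n ^ p →
                    (t + d) ^ suc p ≤ (2 * c) ^ suc p * n ^ p
codegree-power-bound t d n c t≤d hyp = begin
  k ^ suc p                                     ≡⟨⟩
  k ^ (suc (suc t) * suc t)                     ≡⟨ ^-*-assoc k (suc (suc t)) (suc t) ⟨
  (k * (k * k ^ t)) ^ suc t                     ≡⟨ cong (_^ suc t) (*-assoc k k _) ⟨
  -- Since `t ≤ d`, passing from `k` to `d` costs only a factor `2 ^ t`.
  (k * k * k ^ t) ^ suc t                       ≤⟨ ^-monoˡ-≤ (suc t) (*-monoʳ-≤ (k * k) (^-monoˡ-≤ t k≤2d)) ⟩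
  (k * k * (2 * d) ^ t) ^ suc t                 ≡⟨ cong (λ x → (k * k * x) ^ suc t) (^-distribʳ-* 2 d t) ⟩
  (k * k * (2 ^ t * d ^ t)) ^ suc t             ≡⟨ cong (_^ suc t) (x∙yz≈y∙xz (k * k) (2 ^ t) _) ⟩
  (2 ^ t * (k * k * d ^ t)) ^ suc t             ≡⟨ ^-distribʳ-* (2 ^ t) _ (suc t) ⟩
  (2 ^ t) ^ suc t * (k * k * d ^ t) ^ suc t     ≤⟨ *-mono-≤ (≤-reflexive (^-*-assoc 2 t (suc t))) hyp ⟩
  -- Both exponents are enlarged to `suc p`, so that the constant becomes a perfect power, as in the
  -- cleared form of `k ≤ 2c * n ^ (p / (1 + p))`.
  2 ^ (t * suc t) * (c ^ suc t * n ^ p)         ≤⟨ *-mono-≤ (^-monoʳ-≤ 2 2-exponent)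
                                                   (*-monoˡ-≤ (n ^ p) (^-monoʳ-≤ c c-exponent)) ⟩
  2 ^ suc p * (c ^ suc p * n ^ p)               ≡⟨ *-assoc (2 ^ suc p) _ _ ⟨
  2 ^ suc p * c ^ suc p * n ^ p                 ≡⟨ cong (_* n ^ p) (^-distribʳ-* 2 c (suc p)) ⟨
  (2 * c) ^ suc p * n ^ p                       ∎
  where
  open ≤-Reasoning
  k = t + d
  p = t + (suc t + t * suc t)

  k≤2d : k ≤ 2 * d
  k≤2d = ≤-trans (+-monoˡ-≤ d t≤d) (≤-reflexive (cong (d +_) (sym (+-identityʳ d))))

  2-exponent : t * suc t ≤ suc p
  2-exponent = ≤-trans (m≤n+m _ (suc t)) (m≤n+m _ (suc t))

  c-exponent : suc t ≤ suc p
  c-exponent = m≤m+n (suc t) _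

-- Graphs without a complete bipartite subgraph, and their use as common links

-- No `K_{t,t}` in `G`. The sides may be longer than `t`, so that lists obtained from counting
-- bounds serve without trimming.
NoBiclique : ℕ → (A → A → Set) → Set
NoBiclique t G = ∀ {xs ys} → Unique xs → Unique ys → t ≤ length xs → t ≤ length ys →
                 ¬ (∀ {x y} → x List.∈ xs → y List.∈ ys → G x y)

module _ {V : Set} (_≟ⱽ_ : DecidableEquality V) {vs : List V} (uvs : Unique vs) where

  degree : {G : V → V → Set} → Decidable₂ G → V → ℕ
  degree G? x = count (G? x) vs

  size : {G : V → V → Set} → Decidable₂ G → ℕ
  size G? = sum (map (degree G?) vs)

  module _ {N : ℕ} (|vs|≤N : length vs ≤ N) {t : ℕ} where

    module _ {G : V → V → Set} (G? : Decidable₂ G) (free : NoBiclique t G) where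

      -- A Kővári-Sós-Turán argument. The vertices `xs` of degree at least `t + D` contribute at
      -- most `N` each, all others less than `t + D`. Greedily chosen `ys` have at least
      -- `length xs * (D / N) ^ t` common neighbours in `xs`, and this number is below `t`.
      size-threshold : ∀ {D} → 0 ℕ.< D →
                       size G? * D ^ t ≤ t * N ^ suc t + N * (t + D) * D ^ t
      size-threshold {D} 0<D = begin
        size G? * D ^ t
          ≤⟨ *-monoˡ-≤ (D ^ t) (sum≤count rich? (degree G?) N (t + D) vs
               (λ x → ≤-trans (length-filter (G? x) vs) |vs|≤N) (<⇒≤ ∘ ≰⇒>)) ⟩
        (length xs * N + length vs * (t + D)) * D ^ t
          ≤⟨ *-monoˡ-≤ (D ^ t) (+-monoʳ-≤ (length xs * N) (*-monoˡ-≤ (t + D) |vs|≤N)) ⟩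
        (length xs * N + N * (t + D)) * D ^ t
          ≡⟨ *-distribʳ-+ (D ^ t) (length xs * N) _ ⟩
        length xs * N * D ^ t + N * (t + D) * D ^ t
          ≤⟨ +-monoˡ-≤ (N * (t + D) * D ^ t) few ⟩
        t * N ^ suc t + N * (t + D) * D ^ t  ∎
        where
        open ≤-Reasoning
        rich? = λ x → t + D ≤? degree G? x
        xs = filter rich? vs

        few′ : ∀ {ys} → Unique ys → length ys ≡ t →
               length xs * D ^ t ≤ count (λ x → all? (G? x) ys) xs * N ^ t →
               length xs * N * D ^ t ≤ t * N ^ suc t
        few′ {ys} uys |ys| bound with t ≤? count (λ x → all? (G? x) ys) xs
        -- These common neighbours and `ys` are the two sides of a `K_{t,t}`.
        ... | yes t≤ = ⊥-elim $
          free (Unique.filter⁺ _ (Unique.filter⁺ rich? uvs)) uys t≤ (≤-reflexive (sym |ys|))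
            (λ x∈ → All.lookup (proj₂ (∈-filter⁻ (λ x → all? (G? x) ys) {xs = xs} x∈)))
        ... | no t≰ = begin
          length xs * N * D ^ t  ≡⟨ xy∙z≈xz∙y (length xs) N _ ⟩
          length xs * D ^ t * N  ≤⟨ *-monoˡ-≤ N bound ⟩
          count (λ x → all? (G? x) ys) xs * N ^ t * N
                                 ≤⟨ *-monoˡ-≤ N (*-monoˡ-≤ (N ^ t) (<⇒≤ (≰⇒> t≰))) ⟩
          t * N ^ t * N          ≡⟨ *-assoc t _ N ⟩
          t * (N ^ t * N)        ≡⟨ cong (t *_) (*-comm _ N) ⟩
          t * N ^ suc t          ∎

        few : length xs * N * D ^ t ≤ t * N ^ suc t
        few with 0 <? length xs
        ... | no  empty = ≤-trans (≤-reflexive (cong (λ l → l * N * D ^ t) (n<1⇒n≡0 (≰⇒> empty)))) z≤n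
        ... | yes 0<xs =
          let ys , uys , _ , |ys| , bound =
                select _≟ⱽ_ G? t 0<D xs 0<xs uvs |vs|≤N (proj₂ ∘ ∈-filter⁻ rich? {xs = vs})
          in few′ uys |ys| bound

      -- With the root cleared, this says that the size is `O(N ^ (2 - 1 / (t + 1)))`.
      size-bound : .{{NonZero N}} → size G? ^ suc t ≤ (4 * suc t) ^ suc t * N ^ (t + suc t)
      size-bound = threshold⇒power-bound t (size G?) N size-threshold

    module _ {E : V → V → V → Set} (E? : ∀ x y z → Dec (E x y z))
             (swap₁₂ : ∀ {x y z} → E x y z → E y x z) (swap₂₃ : ∀ {x y z} → E x y z → E x z y)
             (free : ∀ {zs} → Unique zs → t ≤ length zs →
                     NoBiclique t (λ x y → All (E x y) zs))
             {d : ℕ} (0<d : 0 ℕ.< d) (codeg : ∀ {x y z} → E x y z → t + d ≤ count (E? x y) vs)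
             .{{_ : NonZero N}}
             where

      private
        k = t + d

        0<k : 0 ℕ.< k
        0<k = ≤-trans 0<d (m≤n+m d t)

        -- By codeg, these include all pairs contained in an edge.
        covered? : Decidable₂ (λ x y → k ≤ count (E? x y) vs)
        covered? x y = k ≤? count (E? x y) vs

        -- `codeg` supplies `k` vertices `w` with `E x y w`. Each pair `x`, `w` lies in an edge,
        -- hence is covered.
        degree-covered : ∀ {x y z} → E x y z → k ≤ count (covered? x) vs
        degree-covered xyz = ≤-trans (codeg xyz) (count-mono (codeg ∘ swap₂₃) vs)

        pairs = filter (uncurry covered?) (cartesianProduct vs vs)

        -- There are `k` vertices `w` with `E x y w`, and each of them, lying in an edge, is the
        -- first vertex of `k` covered pairs.
        k²≤∣pairs∣ : ∀ {x y z} → E x y z → k * k ≤ length pairs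
        k²≤∣pairs∣ {x} {y} xyz = begin
          k * k                                         ≤⟨ *-monoˡ-≤ k (codeg xyz) ⟩
          count (E? x y) vs * k                         ≤⟨ count*≤sum (E? x y) _ k vs
                                                             (λ _ xyw → degree-covered (swap₁₂ (swap₂₃ xyw))) ⟩
          sum (map (λ v → count (covered? v) vs) vs)    ≡⟨ count-× covered? vs vs ⟨
          length pairs                                  ∎
          where open ≤-Reasoning

      -- Greedy choice on the covered pairs gives `t` vertices `zs` whose common link contains at
      -- least `k * k * (d / N) ^ t` of these pairs. The link has no `K_{t,t}`, so `size-bound`
      -- applies; the exponents `2t + 1` and `t(t + 1)` of `N` add up.
      tripartite-bound : ∀ {x y z} → E x y z →
        (k * k * d ^ t) ^ suc t ≤ (4 * suc t) ^ suc t * N ^ (t + (suc t + t * suc t))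
      tripartite-bound xyz
        with zs , uzs , _ , |zs| , bound ←
          select _≟ⱽ_ {R = λ (x , y) → E x y} (λ (x , y) → E? x y) t 0<d pairs
            (<-≤-trans (*-mono-≤ 0<k 0<k) (k²≤∣pairs∣ xyz)) uvs |vs|≤N
            (proj₂ ∘ ∈-filter⁻ (uncurry covered?) {xs = cartesianProduct vs vs}) = begin
        (k * k * d ^ t) ^ suc t                ≤⟨ ^-monoˡ-≤ (suc t) (*-monoˡ-≤ (d ^ t) (k²≤∣pairs∣ xyz)) ⟩
        (length pairs * d ^ t) ^ suc t         ≤⟨ ^-monoˡ-≤ (suc t) bound ⟩
        (count (uncurry G?) pairs * N ^ t) ^ suc t
          ≤⟨ ^-monoˡ-≤ (suc t) (*-monoˡ-≤ (N ^ t) (≤-trans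
               (count-filter (λ g _ → g) (cartesianProduct vs vs)) (≤-reflexive (count-× G? vs vs)))) ⟩
        (size G? * N ^ t) ^ suc t              ≡⟨ ^-distribʳ-* (size G?) (N ^ t) (suc t) ⟩
        size G? ^ suc t * (N ^ t) ^ suc t
          ≤⟨ *-mono-≤ (size-bound G? (free uzs (≤-reflexive (sym |zs|)))) (≤-reflexive (^-*-assoc N t (suc t))) ⟩
        (4 * suc t) ^ suc t * N ^ (t + suc t) * N ^ (t * suc t)
          ≡⟨ *-assoc ((4 * suc t) ^ suc t) _ _ ⟩
        (4 * suc t) ^ suc t * (N ^ (t + suc t) * N ^ (t * suc t))
          ≡⟨ cong ((4 * suc t) ^ suc t *_) (^-distribˡ-+-* N (t + suc t) _) ⟨
        (4 * suc t) ^ suc t * N ^ (t + suc t + t * suc t)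
          ≡⟨ cong (λ e → (4 * suc t) ^ suc t * N ^ e) (+-assoc t (suc t) _) ⟩
        (4 * suc t) ^ suc t * N ^ (t + (suc t + t * suc t))  ∎
        where
        open ≤-Reasoning
        G? : Decidable₂ (λ x y → All (E x y) zs)
        G? x y = all? (E? x y) zs

-- Three-element subsets as triples

∣⁅x⁆∪p∣ : ∀ {x : Fin n} {p} → x ∉ p → ∣ ⁅ x ⁆ ∪ p ∣ ≡ suc ∣ p ∣
∣⁅x⁆∪p∣ {x = Fin.zero}  {inside  ∷ p} x∉p = contradiction here x∉p
∣⁅x⁆∪p∣ {x = Fin.zero}  {outside ∷ p} x∉p = cong (suc ∘ ∣_∣) (∪-identityˡ p)
∣⁅x⁆∪p∣ {x = Fin.suc x} {inside  ∷ p} x∉p = cong suc (∣⁅x⁆∪p∣ (x∉p ∘ there))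
∣⁅x⁆∪p∣ {x = Fin.suc x} {outside ∷ p} x∉p = ∣⁅x⁆∪p∣ (x∉p ∘ there)

∣p∣>0⇒member : ∀ {p : Subset n} {k} → ∣ p ∣ ≡ suc k → ∃ (_∈ p)
∣p∣>0⇒member {p = inside  ∷ p} _  = Fin.zero , here
∣p∣>0⇒member {p = outside ∷ p} eq = let x , x∈p = ∣p∣>0⇒member eq in Fin.suc x , there x∈p

split : ∀ {x : Fin n} {p k} → x ∈ p → ∣ p ∣ ≡ suc k → ∃ λ q → p ≡ ⁅ x ⁆ ∪ q × x ∉ q × ∣ q ∣ ≡ k
split {p = _ ∷ p} here eq = outside ∷ p , cong (inside ∷_) (sym (∪-identityˡ p)) , (λ ()) , suc-injective eq
-- The head is already the only element, so the tail cannot contain `x`.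
split {x = Fin.suc x} {p = inside ∷ p} {zero} (there x∈p) eq =
  contradiction (x∈p⇒∣p-x∣<∣p∣ x∈p) (λ lt → n≮0 (≤-trans lt (≤-reflexive (suc-injective eq))))
split {p = inside ∷ p} {suc k} (there x∈p) eq =
  let q , p≡ , x∉q , ∣q∣ = split x∈p (suc-injective eq)
  in inside ∷ q , cong (inside ∷_) p≡ , x∉q ∘ drop-there , cong suc ∣q∣
split {p = outside ∷ p} (there x∈p) eq =
  let q , p≡ , x∉q , ∣q∣ = split x∈p eq
  in outside ∷ q , cong (outside ∷_) p≡ , x∉q ∘ drop-there , ∣q∣

∣p∣≡1⇒singleton : ∀ {p : Subset n} → ∣ p ∣ ≡ 1 → ∃ λ x → p ≡ ⁅ x ⁆
∣p∣≡1⇒singleton {p = p} eq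
  with x , x∈p ← ∣p∣>0⇒member {p = p} eq
  with q , p≡ , _ , ∣q∣≡0 ← split x∈p eq =
  x , (begin
    p          ≡⟨ p≡ ⟩
    ⁅ x ⁆ ∪ q  ≡⟨ cong (⁅ x ⁆ ∪_) (Empty-unique λ (y , y∈q) →
                    n≮0 (≤-trans (x∈p⇒∣p-x∣<∣p∣ y∈q) (≤-reflexive ∣q∣≡0))) ⟩
    ⁅ x ⁆ ∪ ⊥  ≡⟨ ∪-identityʳ _ ⟩
    ⁅ x ⁆      ∎)
  where open ≡-Reasoning

triple : Fin n → Fin n → Fin n → Subset n
triple x y z = ⁅ x ⁆ ∪ (⁅ y ⁆ ∪ ⁅ z ⁆)

∈-triple⁻ : ∀ {x y z w : Fin n} → w ∈ triple x y z → w ≡ x ⊎ w ≡ y ⊎ w ≡ z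
∈-triple⁻ {x = x} {y} {z} w∈ with x∈p∪q⁻ ⁅ x ⁆ _ w∈
... | inj₁ w∈x = inj₁ (x∈⁅y⁆⇒x≡y x w∈x)
... | inj₂ w∈yz with x∈p∪q⁻ ⁅ y ⁆ _ w∈yz
...   | inj₁ w∈y = inj₂ (inj₁ (x∈⁅y⁆⇒x≡y y w∈y))
...   | inj₂ w∈z = inj₂ (inj₂ (x∈⁅y⁆⇒x≡y z w∈z))

∈-triple₁ : ∀ {x y z : Fin n} → x ∈ triple x y z
∈-triple₁ {x = x} = x∈p∪q⁺ (inj₁ (x∈⁅x⁆ x))

∈-triple₂ : ∀ {x y z : Fin n} → y ∈ triple x y z
∈-triple₂ {x = x} {y} = x∈p∪q⁺ {p = ⁅ x ⁆} (inj₂ (x∈p∪q⁺ (inj₁ (x∈⁅x⁆ y))))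

∈-triple₃ : ∀ {x y z : Fin n} → z ∈ triple x y z
∈-triple₃ {x = x} {y} {z} = x∈p∪q⁺ {p = ⁅ x ⁆} (inj₂ (x∈p∪q⁺ {p = ⁅ y ⁆} (inj₂ (x∈⁅x⁆ z))))

triple-swap₂₃ : ∀ (x y z : Fin n) → triple x y z ≡ triple x z y
triple-swap₂₃ x y z = cong (⁅ x ⁆ ∪_) (∪-comm ⁅ y ⁆ ⁅ z ⁆)

triple-swap₁₂ : ∀ (x y z : Fin n) → triple x y z ≡ triple y x z
triple-swap₁₂ x y z = begin
  ⁅ x ⁆ ∪ (⁅ y ⁆ ∪ ⁅ z ⁆)  ≡⟨ ∪-assoc ⁅ x ⁆ ⁅ y ⁆ ⁅ z ⁆ ⟨
  (⁅ x ⁆ ∪ ⁅ y ⁆) ∪ ⁅ z ⁆  ≡⟨ cong (_∪ ⁅ z ⁆) (∪-comm ⁅ x ⁆ ⁅ y ⁆) ⟩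
  (⁅ y ⁆ ∪ ⁅ x ⁆) ∪ ⁅ z ⁆  ≡⟨ ∪-assoc ⁅ y ⁆ ⁅ x ⁆ ⁅ z ⁆ ⟩
  ⁅ y ⁆ ∪ (⁅ x ⁆ ∪ ⁅ z ⁆)  ∎
  where open ≡-Reasoning

∣pair∣ : ∀ {x y : Fin n} → x ≢ y → ∣ ⁅ x ⁆ ∪ ⁅ y ⁆ ∣ ≡ 2
∣pair∣ {y = y} x≢y = trans (∣⁅x⁆∪p∣ (x≢y ∘ x∈⁅y⁆⇒x≡y y)) (cong suc (∣⁅x⁆∣≡1 y))

∣triple∣ : ∀ {x y z : Fin n} → x ≢ y → x ≢ z → y ≢ z → ∣ triple x y z ∣ ≡ 3
∣triple∣ {y = y} {z} x≢y x≢z y≢z = trans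
  (∣⁅x⁆∪p∣ λ x∈ → [ x≢y ∘ x∈⁅y⁆⇒x≡y y , x≢z ∘ x∈⁅y⁆⇒x≡y z ]′ (x∈p∪q⁻ ⁅ y ⁆ _ x∈))
  (cong suc (∣pair∣ y≢z))

-- A repeated vertex would collapse the union to one or two elements.
∣triple∣≡3⇒≢ : ∀ {x y z : Fin n} → ∣ triple x y z ∣ ≡ 3 → x ≢ y
∣triple∣≡3⇒≢ {x = x} {z = z} eq refl = absurd (x Fin.≟ z)
  where
  double : triple x x z ≡ ⁅ x ⁆ ∪ ⁅ z ⁆
  double = trans (sym (∪-assoc ⁅ x ⁆ ⁅ x ⁆ ⁅ z ⁆)) (cong (_∪ ⁅ z ⁆) (∪-idem ⁅ x ⁆))

  absurd : ¬ Dec (x ≡ z)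
  absurd (no x≢z) with () ← trans (sym eq) (trans (cong ∣_∣ double) (∣pair∣ x≢z))
  absurd (yes refl) with () ←
    trans (sym eq) (trans (cong ∣_∣ (trans double (∪-idem ⁅ x ⁆))) (∣⁅x⁆∣≡1 x))

third-vertex : ∀ {e} {x y : Fin n} → ∣ e ∣ ≡ 3 → x ≢ y → x ∈ e → y ∈ e → ∃ λ z → e ≡ triple x y z
third-vertex {x = x} {y} ∣e∣≡3 x≢y x∈e y∈e
  with q , refl , _ , ∣q∣≡2 ← split x∈e ∣e∣≡3
  with x∈p∪q⁻ ⁅ x ⁆ q y∈e
... | inj₁ y∈x = contradiction (sym (x∈⁅y⁆⇒x≡y x y∈x)) x≢y
... | inj₂ y∈q
  with r , refl , _ , ∣r∣≡1 ← split y∈q ∣q∣≡2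
  with z , refl ← ∣p∣≡1⇒singleton {p = r} ∣r∣≡1 = z , refl

∣e∣≡3⇒triple : ∀ {e : Subset n} → ∣ e ∣ ≡ 3 → ∃ λ x → ∃ λ y → ∃ λ z → e ≡ triple x y z
∣e∣≡3⇒triple {e = e} ∣e∣≡3
  with x , x∈e ← ∣p∣>0⇒member {p = e} ∣e∣≡3
  with q , refl , x∉q , ∣q∣≡2 ← split x∈e ∣e∣≡3
  with y , y∈q ← ∣p∣>0⇒member {p = q} ∣q∣≡2 =
  let z , e≡ = third-vertex ∣e∣≡3 (λ { refl → x∉q y∈q }) x∈e (x∈p∪q⁺ {p = ⁅ x ⁆} (inj₂ y∈q)) in x , y , z , e≡

image-triple : ∀ (f : Fin m → Fin n) x y z → image f (triple x y z) ≡ triple (f x) (f y) (f z)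
image-triple f x y z = ⊆-antisym ⊆-triple triple-⊆
  where
  ⊆-triple : image f (triple x y z) ⊆ triple (f x) (f y) (f z)
  ⊆-triple w∈ with v , v∈ , refl ← Equivalence.to (∈-image f _ _) w∈ with ∈-triple⁻ v∈
  ... | inj₁ refl        = ∈-triple₁
  ... | inj₂ (inj₁ refl) = ∈-triple₂ {x = f x}
  ... | inj₂ (inj₂ refl) = ∈-triple₃ {x = f x} {f y}

  triple-⊆ : triple (f x) (f y) (f z) ⊆ image f (triple x y z)
  triple-⊆ {w} w∈ = Equivalence.from (∈-image f _ w) (preimage (∈-triple⁻ w∈))
    where
    preimage : w ≡ f x ⊎ w ≡ f y ⊎ w ≡ f z → ∃ λ v → v ∈ triple x y z × f v ≡ w
    preimage (inj₁ refl)        = x , ∈-triple₁ , refl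
    preimage (inj₂ (inj₁ refl)) = y , ∈-triple₂ {x = x} , refl
    preimage (inj₂ (inj₂ refl)) = z , ∈-triple₃ {x = x} {y} , refl

-- Adjacency and codegrees in a 3-graph

module _ (H : ThreeGraph n) where

  -- Edges as a symmetric ternary relation, the form used in the counting argument. Uniformity
  -- excludes triples with a repeated vertex.
  Adj : Fin n → Fin n → Fin n → Set
  Adj x y z = Edge H (triple x y z)

  adj? : ∀ x y z → Dec (Adj x y z)
  adj? x y z = edge? H (triple x y z)

  adj-swap₁₂ : ∀ {x y z} → Adj x y z → Adj y x z
  adj-swap₁₂ {x} {y} {z} = subst (Edge H) (triple-swap₁₂ x y z)

  adj-swap₂₃ : ∀ {x y z} → Adj x y z → Adj x z y
  adj-swap₂₃ {x} {y} {z} = subst (Edge H) (triple-swap₂₃ x y z)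

  adj⇒≢ : ∀ {x y z} → Adj x y z → x ≢ y
  adj⇒≢ {x} {y} {z} xyz = ∣triple∣≡3⇒≢ {x = x} {y} {z} (All.lookup (uniform H) xyz)

  edge⇒adj : ∃ (Edge H) → ∃ λ x → ∃ λ y → ∃ λ z → Adj x y z
  edge⇒adj (e , e∈H) =
    let x , y , z , e≡ = ∣e∣≡3⇒triple (All.lookup (uniform H) e∈H) in x , y , z , subst (Edge H) e≡ e∈H

  module _ {x y : Fin n} (x≢y : x ≢ y) where

    -- An edge through `x` and `y` is determined by its third vertex.
    codegree≤count : codegree H x y ≤ count (adj? x y) (allFin n)
    codegree≤count = length-≤ {R = λ e z → e ≡ triple x y z}
      (Unique.filter⁺ (joins? x y) (distinct H)) (filter (adj? x y) (allFin n))
      (λ e∈ → let e∈H , x∈e , y∈e = ∈-filter⁻ (joins? x y) {xs = edges H} e∈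
                  z , e≡ = third-vertex (All.lookup (uniform H) e∈H) x≢y x∈e y∈e
              in z , ∈-filter⁺ (adj? x y) (∈-allFin z) (subst (Edge H) e≡ e∈H) , e≡)
      (λ _ _ e≡ e′≡ → trans e≡ (sym e′≡))

    -- Different third vertices give different edges, because a third vertex is neither `x` nor `y`.
    count≤codegree : count (adj? x y) (allFin n) ≤ codegree H x y
    count≤codegree = length-≤ {R = λ z e → triple x y z ≡ e}
      (Unique.filter⁺ (adj? x y) (Unique.allFin⁺ n)) (filter (joins? x y) (edges H))
      (λ {z} z∈ → triple x y z ,
        ∈-filter⁺ (joins? x y) (adj z∈) (∈-triple₁ , ∈-triple₂ {x = x}) , refl)
      (λ z∈ _ eq eq′ → inj (adj z∈) (trans eq (sym eq′)))
      where
      adj : ∀ {z} → z List.∈ filter (adj? x y) (allFin n) → Adj x y z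
      adj = proj₂ ∘ ∈-filter⁻ (adj? x y) {xs = allFin n}

      inj : ∀ {z z′} → Adj x y z → triple x y z ≡ triple x y z′ → z ≡ z′
      inj {z} {z′} xyz eq with ∈-triple⁻ (subst (z ∈_) eq (∈-triple₃ {x = x} {y}))
      ... | inj₁ refl        = contradiction refl (adj⇒≢ (adj-swap₂₃ xyz))
      ... | inj₂ (inj₁ refl) = contradiction refl (adj⇒≢ (adj-swap₂₃ (adj-swap₁₂ xyz)))
      ... | inj₂ (inj₂ z≡z′) = z≡z′

  δ₂⁺≤count : ∀ {x y z} → Adj x y z → δ₂⁺ H ≤ count (adj? x y) (allFin n)
  δ₂⁺≤count {x} {y} {z} xyz = ≤-trans
    (proj₁ (δ₂⁺-isMaximum H (_ , xyz)) x y (adj⇒≢ xyz) (_ , xyz , ∈-triple₁ , ∈-triple₂ {x = x}))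
    (codegree≤count (adj⇒≢ xyz))

δ₂⁺≤n : ∀ (H : ThreeGraph n) → δ₂⁺ H ≤ n
δ₂⁺≤n {n} H with Fin.any? (λ x → Fin.any? λ y → Fin.any? λ z → adj? H x y z)
... | yes (x , y , z , xyz) = begin
  δ₂⁺ H                           ≤⟨ δ₂⁺≤count H xyz ⟩
  count (adj? H x y) (allFin n)   ≤⟨ length-filter (adj? H x y) (allFin n) ⟩
  length (allFin n)               ≡⟨ length-tabulate id ⟩
  n                               ∎
  where open ≤-Reasoning
-- Without an adjacent triple `H` has no edges, and its co-degree is 0 by convention.
... | no ¬xyz = ≤-trans (≤-reflexive (δ₂⁺-empty H λ e e∈H → ¬xyz (edge⇒adj H (e , e∈H)))) z≤n

-- Embedding a 3-partite 3-graph into a complete one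

lookup-injective : ∀ {A : Set} {xs : List A} → Unique xs → Injective _≡_ _≡_ (lookup xs)
lookup-injective (_ ∷ _)    {Fin.zero}  {Fin.zero}  _  = refl
lookup-injective (x∉ ∷ _)   {Fin.zero}  {Fin.suc j} eq = contradiction eq (All.lookup x∉ (∈-lookup j))
lookup-injective (x∉ ∷ _)   {Fin.suc i} {Fin.zero}  eq = contradiction (sym eq) (All.lookup x∉ (∈-lookup i))
lookup-injective (_ ∷ uxs)  {Fin.suc i} {Fin.suc j} eq = cong Fin.suc (lookup-injective uxs eq)

enumerate : ∀ {A : Set} {xs : List A} → Unique xs → m ≤ length xs →
            ∃ λ (f : Fin m → A) → Injective _≡_ _≡_ f × (∀ i → f i List.∈ xs)
enumerate {xs = xs} uxs m≤ =
  (λ i → lookup xs (inject≤ i m≤)) ,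
  (λ eq → Fin.inject≤-injective m≤ m≤ _ _ (lookup-injective uxs eq)) ,
  (λ i → ∈-lookup {xs = xs} (inject≤ i m≤))

-- Decided by running through all pairs of classes.
thirdClass : ∀ (i j : Fin 3) → ∃ λ k → i ≢ k × j ≢ k
thirdClass = from-yes
  (Fin.all? λ i → Fin.all? λ j → Fin.any? {n = 3} λ k → ¬? (i Fin.≟ k) ×-dec ¬? (j Fin.≟ k))

module _ (H : ThreeGraph n) (part : Fin 3 → Fin m → Fin n)
         (adj : ∀ a b c → Adj H (part 0F a) (part 1F b) (part 2F c)) where

  -- The two transpositions generate all six orders of the classes; the remaining clauses repeat a
  -- class.
  adj-classes : ∀ {i j k} → i ≢ j → i ≢ k → j ≢ k → ∀ a b c →
                Adj H (part i a) (part j b) (part k c)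
  adj-classes {0F} {1F} {2F} _ _ _ a b c = adj a b c
  adj-classes {0F} {2F} {1F} _ _ _ a b c = adj-swap₂₃ H (adj a c b)
  adj-classes {1F} {0F} {2F} _ _ _ a b c = adj-swap₁₂ H (adj b a c)
  adj-classes {1F} {2F} {0F} _ _ _ a b c = adj-swap₂₃ H (adj-swap₁₂ H (adj c a b))
  adj-classes {2F} {0F} {1F} _ _ _ a b c = adj-swap₁₂ H (adj-swap₂₃ H (adj b c a))
  adj-classes {2F} {1F} {0F} _ _ _ a b c = adj-swap₁₂ H (adj-swap₂₃ H (adj-swap₁₂ H (adj c b a)))
  adj-classes {0F} {0F}      i≢j _ _ _ _ _ = contradiction refl i≢j
  adj-classes {1F} {1F}      i≢j _ _ _ _ _ = contradiction refl i≢j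
  adj-classes {2F} {2F}      i≢j _ _ _ _ _ = contradiction refl i≢j
  adj-classes {0F} {_} {0F}  _ i≢k _ _ _ _ = contradiction refl i≢k
  adj-classes {1F} {_} {1F}  _ i≢k _ _ _ _ = contradiction refl i≢k
  adj-classes {2F} {_} {2F}  _ i≢k _ _ _ _ = contradiction refl i≢k
  adj-classes {_} {0F} {0F}  _ _ j≢k _ _ _ = contradiction refl j≢k
  adj-classes {_} {1F} {1F}  _ _ j≢k _ _ _ = contradiction refl j≢k
  adj-classes {_} {2F} {2F}  _ _ j≢k _ _ _ = contradiction refl j≢k

  -- Each part has one vertex for every vertex of `F`, so `v` can be sent to the vertex with index
  -- `v` in the part of its own class.
  copy : (∀ i → Injective _≡_ _≡_ (part i)) → (F : ThreeGraph m) → ThreePartite F → ∃ (IsCopy F H)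
  copy part-injective F (class , proper) = f , f-injective , f-edge
    where
    f : Fin m → Fin n
    f v = part (class v) v

    f-injective : Injective _≡_ _≡_ f
    f-injective {u} {v} fu≡fv with class u Fin.≟ class v
    ... | yes cu≡cv = part-injective (class v) (trans (cong (λ i → part i u) (sym cu≡cv)) fu≡fv)
    ... | no  cu≢cv =
      let k , cu≢k , cv≢k = thirdClass (class u) (class v)
      -- A vertex of the third part completes the two images to an edge, so they differ. Its index
      -- `u` is an arbitrary choice.
      in contradiction fu≡fv (adj⇒≢ H (adj-classes cu≢cv cu≢k cv≢k u v u))

    f-edge : ∀ e → Edge F e → Edge H (image f e)
    f-edge e e∈F with x , y , z , refl ← ∣e∣≡3⇒triple {e = e} (All.lookup (uniform F) e∈F) =
      subst (Edge H) (sym (image-triple f x y z))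
        (adj-classes (adj⇒≢ F e∈F ∘ proper e e∈F x y x∈ y∈)
                     (adj⇒≢ F (adj-swap₂₃ F e∈F) ∘ proper e e∈F x z x∈ z∈)
                     (adj⇒≢ F (adj-swap₂₃ F (adj-swap₁₂ F e∈F)) ∘ proper e e∈F y z y∈ z∈) x y z)
      where
      x∈ = ∈-triple₁
      y∈ = ∈-triple₂ {x = x}
      z∈ = ∈-triple₃ {x = x} {y}

-- The upper bound for 3-partite `F`

module _ (F : ThreeGraph m) (F-partite : ThreePartite F) (H : ThreeGraph n) (free : Free F H) where

  -- A `K_{m,m}` in the common link of `m` vertices is a `K_{m,m,m}` in `H`, which contains `F`.
  no-biclique : ∀ {zs} → Unique zs → m ≤ length zs →
                NoBiclique m (λ x y → All (Adj H x y) zs)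
  no-biclique {zs} uzs m≤zs {xs} {ys} uxs uys m≤xs m≤ys adj =
    free (copy H part (λ a b c → All.lookup (adj (x∈ a) (y∈ b)) (z∈ c)) part-injective F F-partite)
    where
    enum-x = enumerate uxs m≤xs
    enum-y = enumerate uys m≤ys
    enum-z = enumerate uzs m≤zs
    x∈ = proj₂ (proj₂ enum-x)
    y∈ = proj₂ (proj₂ enum-y)
    z∈ = proj₂ (proj₂ enum-z)

    part : Fin 3 → Fin m → Fin n
    part 0F = proj₁ enum-x
    part 1F = proj₁ enum-y
    part 2F = proj₁ enum-z

    part-injective : ∀ i → Injective _≡_ _≡_ (part i)
    part-injective 0F = proj₁ (proj₂ enum-x)
    part-injective 1F = proj₁ (proj₂ enum-y)
    part-injective 2F = proj₁ (proj₂ enum-z)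

  private
    p = m + (suc m + m * suc m)

  δ₂⁺-bound : .{{NonZero n}} → δ₂⁺ H ^ suc p ≤ (2 * (4 * suc m)) ^ suc p * n ^ p
  δ₂⁺-bound with Fin.any? (λ x → Fin.any? λ y → Fin.any? λ z → adj? H x y z)
  ... | no ¬xyz rewrite δ₂⁺-empty H (λ e e∈H → ¬xyz (edge⇒adj H (e , e∈H))) = z≤n
  ... | yes (x , y , z , xyz) with m + m <? δ₂⁺ H
  -- Co-degrees of at most `2m` are absorbed by the constant.
  ...   | no 2m≮δ = begin
    δ₂⁺ H ^ suc p                        ≤⟨ ^-monoˡ-≤ (suc p) δ≤ ⟩
    (2 * (4 * suc m)) ^ suc p            ≤⟨ m≤m*n _ (n ^ p) {{m^n≢0 n p}} ⟩
    (2 * (4 * suc m)) ^ suc p * n ^ p    ∎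
    where
    open ≤-Reasoning
    δ≤ : δ₂⁺ H ≤ 2 * (4 * suc m)
    δ≤ = begin
      δ₂⁺ H              ≤⟨ ≮⇒≥ 2m≮δ ⟩
      m + m              ≡⟨ cong (m +_) (sym (+-identityʳ m)) ⟩
      2 * m              ≤⟨ *-monoʳ-≤ 2 (≤-trans (n≤1+n m) (m≤n*m (suc m) 4)) ⟩
      2 * (4 * suc m)    ∎
  ...   | yes 2m<δ = subst (λ k → k ^ suc p ≤ (2 * (4 * suc m)) ^ suc p * n ^ p) m+d≡δ
    (codegree-power-bound m d n (4 * suc m) (<⇒≤ m<d)
      (tripartite-bound Fin._≟_ (Unique.allFin⁺ n) (≤-reflexive (length-tabulate id))
        (adj? H) (adj-swap₁₂ H) (adj-swap₂₃ H) no-biclique (≤-<-trans z≤n m<d)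
        (λ uvw → ≤-trans (≤-reflexive m+d≡δ) (δ₂⁺≤count H uvw)) xyz))
    where
    -- The part `m` of the co-degree is reserved for the vertices that the greedy choice uses up.
    d = δ₂⁺ H ∸ m

    m+d≡δ : m + d ≡ δ₂⁺ H
    m+d≡δ = m+[n∸m]≡n (≤-trans (m≤m+n m m) (<⇒≤ 2m<δ))

    m<d : m ℕ.< d
    m<d = +-cancelˡ-< m m d (<-≤-trans 2m<δ (≤-reflexive (sym m+d≡δ)))

-- The exponent `1 - 1 / (1 + p)`

1/[1+_] : ℕ → ℚ
1/[1+ p ] = mkℚ (ℤ.+ 1) p (Coprime.1-coprimeTo (suc p))

-- In lowest terms by construction, so that `_≤_·_^ℚ_` at this exponent unfolds to an inequality
-- between powers.
p/[1+_] : ℕ → ℚ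
p/[1+ p ] = mkℚ (ℤ.+ p) p
  (subst (Coprime p) (+-comm p 1) (Coprime.sym (Coprime.coprime-+ (Coprime.1-coprimeTo p))))

-- The comparison is made between unnormalised fractions, where no common divisor has to be
-- computed.
1-1/[1+p] : ∀ p → 1ℚ - 1/[1+ p ] ≡ p/[1+ p ]
1-1/[1+p] p = ℚ.toℚᵘ-injective (begin
  ℚ.toℚᵘ (1ℚ - 1/[1+ p ])                      ≈⟨ ℚ.toℚᵘ-homo-+ 1ℚ (ℚ.- 1/[1+ p ]) ⟩
  ℚᵘ.1ℚᵘ ℚᵘ.+ ℚ.toℚᵘ (ℚ.- 1/[1+ p ])           ≡⟨⟩
  ℚᵘ.1ℚᵘ ℚᵘ.- ℚ.toℚᵘ 1/[1+ p ]                 ≈⟨ ℚᵘ.*≡* (cong₂ (λ x y → ℤ.+ x ℤ.* ℤ.+ suc y)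
                                                     (+-identityʳ p) (sym (+-identityʳ p))) ⟩
  ℚ.toℚᵘ p/[1+ p ]                             ∎)
  where open ℚᵘ.≃-Reasoning

-- The balanced complete 3-partite 3-graph

classMod3 : Fin n → Fin 3
classMod3 v = toℕ v mod 3

Rainbow : Subset n → Set
Rainbow e = ∀ u v → u ∈ e → v ∈ e → classMod3 u ≡ classMod3 v → u ≡ v

rainbow? : Decidable (Rainbow {n})
rainbow? e = Fin.all? λ u → Fin.all? λ v →
  (u ∈? e) →-dec ((v ∈? e) →-dec ((classMod3 u Fin.≟ classMod3 v) →-dec (u Fin.≟ v)))

-- The classes are the residues modulo 3; `fromList` discards the rainbow sets that do not have
-- three elements.
completeTripartite : ∀ n → ThreeGraph n
completeTripartite n = fromList (filter rainbow? (allSubsets n))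

edge⇒rainbow : ∀ {e : Subset n} → Edge (completeTripartite n) e → Rainbow e
edge⇒rainbow {n} {e} e∈ =
  proj₂ (∈-filter⁻ rainbow? {xs = allSubsets n} (proj₁ (Equivalence.to (edge-fromList _ e) e∈)))

distinct-classes⇒adj : ∀ {x y z : Fin n} → classMod3 x ≢ classMod3 y → classMod3 x ≢ classMod3 z →
                       classMod3 y ≢ classMod3 z → Adj (completeTripartite n) x y z
distinct-classes⇒adj {n} {x} {y} {z} x≢y x≢z y≢z = Equivalence.from (edge-fromList _ (triple x y z))
  (∈-filter⁺ rainbow? (∈-allSubsets _) rainbow ,
   ∣triple∣ {x = x} {y} {z} (x≢y ∘ cong classMod3) (x≢z ∘ cong classMod3) (y≢z ∘ cong classMod3))
  where
  rainbow : Rainbow (triple x y z)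
  rainbow u v u∈ v∈ eq with ∈-triple⁻ u∈ | ∈-triple⁻ v∈
  ... | inj₁ refl        | inj₁ refl        = refl
  ... | inj₁ refl        | inj₂ (inj₁ refl) = contradiction eq x≢y
  ... | inj₁ refl        | inj₂ (inj₂ refl) = contradiction eq x≢z
  ... | inj₂ (inj₁ refl) | inj₁ refl        = contradiction (sym eq) x≢y
  ... | inj₂ (inj₁ refl) | inj₂ (inj₁ refl) = refl
  ... | inj₂ (inj₁ refl) | inj₂ (inj₂ refl) = contradiction eq y≢z
  ... | inj₂ (inj₂ refl) | inj₁ refl        = contradiction (sym eq) x≢z
  ... | inj₂ (inj₂ refl) | inj₂ (inj₁ refl) = contradiction (sym eq) y≢z
  ... | inj₂ (inj₂ refl) | inj₂ (inj₂ refl) = refl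

-- The residue classes, pulled back along a copy of `F`, would make `F` 3-partite.
completeTripartite-free : ∀ {F : ThreeGraph m} → ¬ ThreePartite F → Free F (completeTripartite n)
completeTripartite-free ¬partite (f , f-injective , f-edge) = ¬partite
  (classMod3 ∘ f , λ e e∈F u v u∈e v∈e cu≡cv → f-injective
    (edge⇒rainbow (f-edge e e∈F) (f u) (f v) (∈-image′ u∈e) (∈-image′ v∈e) cu≡cv))
  where
  ∈-image′ : ∀ {e u} → u ∈ e → f u ∈ image f e
  ∈-image′ {e} {u} u∈e = Equivalence.from (∈-image f e (f u)) (u , u∈e , refl)

-- The vertex is `k + 3i`, which is less than `3(i + 1)` and hence than `n`. The explicit value
-- shows later that different `i` give different vertices.
vertex-of-class : ∀ (k : Fin 3) i → i ℕ.< n / 3 → ∃ λ (v : Fin n) → classMod3 v ≡ k × toℕ v ≡ toℕ k + i * 3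
vertex-of-class {n} k i i<n/3 = fromℕ< v<n , Fin.toℕ-injective class≡ , Fin.toℕ-fromℕ< v<n
  where
  v = toℕ k + i * 3
  v<n : v ℕ.< n
  v<n = begin-strict
    toℕ k + i * 3  <⟨ +-monoˡ-< (i * 3) (Fin.toℕ<n k) ⟩
    suc i * 3      ≤⟨ *-monoˡ-≤ 3 i<n/3 ⟩
    n / 3 * 3      ≤⟨ m/n*n≤m n 3 ⟩
    n              ∎
    where open ≤-Reasoning
  class≡ : toℕ (classMod3 (fromℕ< v<n)) ≡ toℕ k
  class≡ = begin
    toℕ (classMod3 (fromℕ< v<n))  ≡⟨ Fin.toℕ-fromℕ< _ ⟩
    toℕ (fromℕ< v<n) % 3          ≡⟨ cong (_% 3) (Fin.toℕ-fromℕ< v<n) ⟩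
    (toℕ k + i * 3) % 3           ≡⟨ [m+kn]%n≡m%n (toℕ k) i 3 ⟩
    toℕ k % 3                     ≡⟨ m<n⇒m%n≡m (Fin.toℕ<n k) ⟩
    toℕ k                         ∎
    where open ≡-Reasoning

-- Two vertices of an edge lie in different classes, and every vertex of the third class completes
-- them to an edge.
completeTripartite-codegree : CodegreeAtLeast (completeTripartite n) (n / 3)
completeTripartite-codegree {n} u v u≢v (e , e∈ , u∈e , v∈e)
  with k , cu≢k , cv≢k ← thirdClass (classMod3 u) (classMod3 v) = begin
  n / 3                    ≡⟨ length-upTo (n / 3) ⟨
  length (upTo (n / 3))    ≤⟨ length-≤ {R = λ i w → toℕ w ≡ toℕ k + i * 3} (Unique.upTo⁺ (n / 3)) _ total
                               (λ _ _ eq eq′ → *-cancelʳ-≡ _ _ 3 (+-cancelˡ-≡ (toℕ k) _ _ (trans (sym eq) eq′))) ⟩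
  count (adj? T u v) (allFin n)  ≤⟨ count≤codegree T u≢v ⟩
  codegree T u v           ∎
  where
  open ≤-Reasoning
  T = completeTripartite n

  total : ∀ {i} → i List.∈ upTo (n / 3) →
          ∃ λ w → w List.∈ filter (adj? T u v) (allFin n) × toℕ w ≡ toℕ k + i * 3
  total i∈ with w , cw , w≡ ← vertex-of-class k _ (∈-upTo⁻ i∈) =
    w , ∈-filter⁺ (adj? T u v) (∈-allFin w)
          (distinct-classes⇒adj (u≢v ∘ edge⇒rainbow e∈ u v u∈e v∈e)
            (λ eq → cu≢k (trans eq cw)) (λ eq → cv≢k (trans eq cw))) , w≡

-- Gives access to `δ₂⁺-isMaximum`, which concerns 3-graphs with an edge.
completeTripartite-nonempty : 3 ≤ n → ∃ (Edge (completeTripartite n))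
completeTripartite-nonempty {n} 3≤n = triple (vertex 0F) (vertex 1F) (vertex 2F) ,
  distinct-classes⇒adj (classes-≢ 0F 1F λ ()) (classes-≢ 0F 2F λ ()) (classes-≢ 1F 2F λ ())
  where
  vertex : Fin 3 → Fin n
  vertex k = proj₁ (vertex-of-class k 0 (m≥n⇒m/n>0 3≤n))

  class-vertex : ∀ k → classMod3 (vertex k) ≡ k
  class-vertex k = proj₁ (proj₂ (vertex-of-class k 0 (m≥n⇒m/n>0 3≤n)))

  classes-≢ : ∀ k l → k ≢ l → classMod3 (vertex k) ≢ classMod3 (vertex l)
  classes-≢ k l k≢l eq = k≢l (trans (sym (class-vertex k)) (trans eq (class-vertex l)))

n/3≤δ₂⁺ : 3 ≤ n → n / 3 ≤ δ₂⁺ (completeTripartite n)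
n/3≤δ₂⁺ {n} 3≤n =
  proj₂ (δ₂⁺-isMaximum (completeTripartite n) (completeTripartite-nonempty 3≤n))
    (n / 3) completeTripartite-codegree

-- With `q = n / 3` at least 1, `n < 3(q + 1) ≤ 6q`.
n≤6*[n/3] : 3 ≤ n → n ≤ 6 * (n / 3)
n≤6*[n/3] {n} 3≤n = begin
  n                          ≤⟨ <⇒≤ (m<[1+m/n]*n n 3) ⟩
  (1 + n / 3) * 3            ≤⟨ *-monoˡ-≤ 3 (+-monoˡ-≤ (n / 3) (m≥n⇒m/n>0 3≤n)) ⟩
  (n / 3 + n / 3) * 3        ≡⟨ solve 1 (λ q → (q :+ q) :* con 3 := con 6 :* q) refl (n / 3) ⟩
  6 * (n / 3)                ∎
  where open ≤-Reasoning

-- The two cases of the dichotomy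

-- Reduces a claim about the extremal number to single `F`-free 3-graphs; `P 0` covers the
-- convention for an empty family.
co⁺ex-elim : ∀ (F : ThreeGraph m) (P : ℕ → Set) → P 0 →
             (∀ (H : ThreeGraph n) → Free F H → P (δ₂⁺ H)) → P (co⁺ex n F)
co⁺ex-elim {n = n} F P p₀ p =
  [ (λ ≡0 → subst P (sym ≡0) p₀) , (λ (H , free , δ≡) → subst P δ≡ (p H free)) ]′
    (co⁺ex-attained n F)

theorem25 : ∀ {m : ℕ} (F : ThreeGraph m) →
    (ThreePartite F →
    ∃ λ (ε : ℚ) → 0ℚ < ε × (λ n → co⁺ex n F) =O[n^ 1ℚ - ε ])
    × (¬ ThreePartite F → (λ n → co⁺ex n F) =Θ id)
theorem25 {m} F = partite , non-partite
  where
  p = m + (suc m + m * suc m)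

  partite : ThreePartite F → ∃ λ (ε : ℚ) → 0ℚ < ε × (λ n → co⁺ex n F) =O[n^ 1ℚ - ε ]
  partite F-partite = 1/[1+ p ] , ℚ.positive⁻¹ 1/[1+ p ] ,
    -- After the exponent is rewritten as `p / (1 + p)`, the `O`-relation unfolds to `bound`.
    -- Starting at 1 makes `n` nonzero.
    subst ((λ n → co⁺ex n F) =O[n^_]) (sym (1-1/[1+p] p)) (2 * (4 * suc m) , 1 , bound)
    where
    bound : ∀ n → 1 ≤ n → co⁺ex n F ^ suc p ≤ (2 * (4 * suc m)) ^ suc p * n ^ p
    bound n@(suc _) _ = co⁺ex-elim F (λ k → k ^ suc p ≤ (2 * (4 * suc m)) ^ suc p * n ^ p) z≤n
      (λ H free → δ₂⁺-bound F F-partite H free)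

  non-partite : ¬ ThreePartite F → (λ n → co⁺ex n F) =Θ id
  -- The 6 comes from `n≤6*[n/3]`; from 3 vertices on, the complete 3-partite 3-graph has an edge.
  non-partite ¬partite = (1 , 0 , λ n _ → upper n) , (6 , 3 , lower)
    where
    upper : ∀ n → co⁺ex n F ≤ 1 * n
    upper n = co⁺ex-elim F (_≤ 1 * n) z≤n
      (λ H _ → ≤-trans (δ₂⁺≤n H) (≤-reflexive (sym (*-identityˡ n))))

    lower : ∀ n → 3 ≤ n → n ≤ 6 * co⁺ex n F
    lower n 3≤n = ≤-trans (n≤6*[n/3] 3≤n) (*-monoʳ-≤ 6
      (≤-trans (n/3≤δ₂⁺ 3≤n) (co⁺ex-upper F (completeTripartite n) (completeTripartite-free {F = F} ¬partite))))
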